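{- Let $\overline{p}$ be a finite set of propositional variables. For every consistent $\mathrm{CTL}^f$-formula $\phi_0(\overline{p})$, there exists a $\overline{p}$-coloured tree with root $s_0$ such that $s_0 \Vdash \phi_0$.
   Context: **Formulas.** $\mathrm{CTL}^f$-formulas with variables in $\overline p$ are the terms built from variables $p\in\overline p$ using the nullary symbol $\bot$, unary symbols $\neg,\Diamond$, and binary symbols $\vee,\mathrm{EU},\mathrm{EG}$. As usual $\top:=\neg\bot$ and $a\wedge b:=\neg(\neg a\vee\neg b)$. **Algebras.** A $\mathrm{CTL}^f$-algebra is a tuple $(A,\bot,\vee,\neg,\Diamond,\mathrm{EU},\mathrm{EG})$ such that $(A,\bot,\vee,\neg)$ is a Boolean algebra ($a\le b$ means $a\vee b=b$); $\Diamond:A\to A$ preserves finite joins including the empty join $\bot$; $\Diamond\top=\top$; and for all $a,b\in A$, $\mathrm{EU}(a,b)$ is the least pre-fixpoint of $x\mapsto a\vee(b\wedge\Diamond x)$ (the least $x$ with $a\vee(b\wedge\Diamond x)\le x$) and $\mathrm{EG}(a,b)$ is the greatest post-fixpoint of $y\mapsto a\wedge\Diamond\mathrm{EU}(b\wedge y,a)$ (the greatest $y$ with $y\le a\wedge\Diamond\mathrm{EU}(b\wedge y,a)$). A formula $\phi(\overline p)$ is *consistent* if there are a $\mathrm{CTL}^f$-algebra $\mathbb A$ and a valuation $V:\overline p\to A$ such that the interpretation of $\phi$ in $\mathbb A$ under $V$ is not $\bot$. **Transition systems and trees.** A transition system is a set $S$ with a binary relation $R$; all transition systems are assumed serial: every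 $s\in S$ has some $s'$ with $sRs'$. An $R$-path is a finite or infinite sequence of nodes with $s_iRs_{i+1}$ for all $i$. A *root* is a node $s_0$ such that every node is reachable by a path from $s_0$, and the only path ending in $s_0$ is the trivial one. A *tree* is a transition system with a root such that for every node $s$ there is a unique path from the root to $s$. A $\overline p$-colouring is a function $\sigma:S\to\mathcal P(\overline p)$; a $\overline p$-coloured tree is a tree with a $\overline p$-colouring. **Forcing.** For a coloured transition system $(S,R,\sigma)$: $s\not\Vdash\bot$; $s\Vdash p$ iff $p\in\sigma(s)$; $s\Vdash\neg\psi$ iff $s\not\Vdash\psi$; $s\Vdash\psi_1\vee\psi_2$ iff $s\Vdash\psi_1$ or $s\Vdash\psi_2$; $s\Vdash\Diamond\psi$ iff some $s'$ with $sRs'$ has $s'\Vdash\psi$; $s\Vdash\mathrm{EU}(\psi_1,\psi_2)$ iff there are $n\ge0$ and an $R$-path $s=s_0,\dots,s_n$ with $s_t\Vdash\psi_2$ for all $t<n$ and $s_n\Vdash\psi_1$; $s\Vdash\mathrm{EG}(\psi_1,\psi_2)$ iff there is an infinite $R$-path $s=s_0,s_1,\dots$ with $s_t\Vdash\psi_1$ for all $t$ and $s_t\Vdash\psi_2$ for infinitely many $t$. -}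

module Defs where

open import Algebra.Lattice.Bundles using (BooleanAlgebra)
open import Data.Empty using (⊥)
open import Data.Fin.Base using (Fin)
open import Data.Fin.Subset using (Subset; _∈_)
open import Data.List.Base using (List; []; _∷_; [_]; _∷ʳ_)
open import Data.List.Relation.Unary.All using (All)
open import Data.Nat.Base using (ℕ; zero; suc; _≤_)
open import Data.Product.Base using (∃; ∃-syntax; _×_)
open import Data.Sum.Base using (_⊎_)
open import Level using (0ℓ; _⊔_) renaming (suc to lsuc)
open import Relation.Binary.Core using (Rel)
open import Relation.Binary.Construct.Closure.ReflexiveTransitive using (Star; ε; _◅_)
open import Relation.Binary.PropositionalEquality.Core using (_≡_)
open import Relation.Nullary.Negation.Core using (¬_)

-- The finite set of propositional variables is Fin n.
data Formula (n : ℕ) : Set where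
  var     : Fin n → Formula n
  ⊥ᶠ      : Formula n
  ¬ᶠ_ ◇ᶠ_ : Formula n → Formula n
  _∨ᶠ_    : Formula n → Formula n → Formula n
  EUᶠ EGᶠ : Formula n → Formula n → Formula n

infix  8 ¬ᶠ_ ◇ᶠ_
infixr 6 _∨ᶠ_

module Order {c ℓ} (B : BooleanAlgebra c ℓ) where
  open BooleanAlgebra B using (Carrier; _≈_; _∨_)

  infix 4 _≼_
  _≼_ : Rel Carrier ℓ
  a ≼ b = a ∨ b ≈ b

  IsLeastPreFixpoint : (Carrier → Carrier) → Carrier → Set (c ⊔ ℓ)
  IsLeastPreFixpoint f x = f x ≼ x × (∀ y → f y ≼ y → x ≼ y)

  IsGreatestPostFixpoint : (Carrier → Carrier) → Carrier → Set (c ⊔ ℓ)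
  IsGreatestPostFixpoint f x = x ≼ f x × (∀ y → y ≼ f y → y ≼ x)

-- Equality is that of the setoid underlying the Boolean algebra, so ◇ is
-- required to respect it.  EU and EG then respect it automatically, since
-- extremal fixpoints are unique up to ≈.
record CTLᶠ-Algebra c ℓ : Set (lsuc (c ⊔ ℓ)) where
  field
    booleanAlgebra : BooleanAlgebra c ℓ

  open BooleanAlgebra booleanAlgebra public
    renaming (⊤ to ⊤ᴬ; ⊥ to ⊥ᴬ; ¬_ to ¬ᴬ_)
  open Order booleanAlgebra public

  field
    ◇      : Carrier → Carrier
    EU EG  : Carrier → Carrier → Carrier
    ◇-cong : ∀ {a b} → a ≈ b → ◇ a ≈ ◇ b
    ◇-⊥    : ◇ ⊥ᴬ ≈ ⊥ᴬ
    ◇-∨    : ∀ a b → ◇ (a ∨ b) ≈ ◇ a ∨ ◇ b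
    ◇-⊤    : ◇ ⊤ᴬ ≈ ⊤ᴬ
    EU-lpf : ∀ a b → IsLeastPreFixpoint (λ x → a ∨ (b ∧ ◇ x)) (EU a b)
    EG-gpf : ∀ a b → IsGreatestPostFixpoint (λ y → a ∧ ◇ (EU (b ∧ y) a)) (EG a b)

module Interpretation {c ℓ} (𝔸 : CTLᶠ-Algebra c ℓ) {n} (V : Fin n → CTLᶠ-Algebra.Carrier 𝔸) where
  open CTLᶠ-Algebra 𝔸

  ⟦_⟧ : Formula n → Carrier
  ⟦ var p ⟧   = V p
  ⟦ ⊥ᶠ ⟧      = ⊥ᴬ
  ⟦ ¬ᶠ φ ⟧    = ¬ᴬ ⟦ φ ⟧
  ⟦ ◇ᶠ φ ⟧    = ◇ ⟦ φ ⟧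
  ⟦ φ ∨ᶠ ψ ⟧  = ⟦ φ ⟧ ∨ ⟦ ψ ⟧
  ⟦ EUᶠ φ ψ ⟧ = EU ⟦ φ ⟧ ⟦ ψ ⟧
  ⟦ EGᶠ φ ψ ⟧ = EG ⟦ φ ⟧ ⟦ ψ ⟧

Consistent : ∀ c ℓ {n} → Formula n → Set (lsuc (c ⊔ ℓ))
Consistent c ℓ {n} φ =
  ∃ λ (𝔸 : CTLᶠ-Algebra c ℓ) → let open CTLᶠ-Algebra 𝔸 in
  ∃ λ (V : Fin n → Carrier) → ¬ (Interpretation.⟦_⟧ 𝔸 V φ ≈ ⊥ᴬ)

record TransitionSystem : Set₁ where
  field
    Node   : Set
    R      : Rel Node 0ℓ
    serial : ∀ s → ∃[ s′ ] R s s′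

  -- Star R s t is the type of finite R-paths from s to t.  R may be
  -- proof-relevant, so equality of paths is equality of their node sequences.
  nonFinalNodes : ∀ {s t} → Star R s t → List Node
  nonFinalNodes         ε       = []
  nonFinalNodes {s = s} (_ ◅ π) = s ∷ nonFinalNodes π

  nodes : ∀ {s t} → Star R s t → List Node
  nodes {t = t} π = nonFinalNodes π ∷ʳ t

  IsRoot : Node → Set
  IsRoot s₀ = (∀ s → Star R s₀ s) × (∀ s (π : Star R s s₀) → nodes π ≡ [ s₀ ])

  InfinitePath : (ℕ → Node) → Set
  InfinitePath f = ∀ t → R (f t) (f (suc t))

record Tree : Set₁ where
  field
    transitionSystem : TransitionSystem

  open TransitionSystem transitionSystem public

  field
    root       : Node
    isRoot     : IsRoot root
    uniquePath : ∀ s → ∃ λ (π : Star R root s) → ∀ (π′ : Star R root s) → nodes π ≡ nodes π′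

Colouring : ℕ → TransitionSystem → Set
Colouring n S = TransitionSystem.Node S → Subset n

record ColouredTree (n : ℕ) : Set₁ where
  field
    tree : Tree

  open Tree tree public

  field
    colouring : Colouring n transitionSystem

module Forcing (S : TransitionSystem) {n} (σ : Colouring n S) where
  open TransitionSystem S

  infix 4 _⊩_
  _⊩_ : Node → Formula n → Set
  s ⊩ var p   = p ∈ σ s
  s ⊩ ⊥ᶠ      = ⊥
  s ⊩ ¬ᶠ ψ    = ¬ (s ⊩ ψ)
  s ⊩ φ ∨ᶠ ψ  = s ⊩ φ ⊎ s ⊩ ψ
  s ⊩ ◇ᶠ ψ    = ∃[ s′ ] R s s′ × s′ ⊩ ψ
  s ⊩ EUᶠ φ ψ = ∃[ s′ ] ∃ λ (π : Star R s s′) → All (λ u → u ⊩ ψ) (nonFinalNodes π) × s′ ⊩ φ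
  s ⊩ EGᶠ φ ψ = ∃[ f ] f zero ≡ s × InfinitePath f
                  × (∀ t → f t ⊩ φ) × (∀ m → ∃[ t ] m ≤ t × f t ⊩ ψ)

infix 4 _,_⊩_
_,_⊩_ : ∀ {n} (T : ColouredTree n) → ColouredTree.Node T → Formula n → Set
T , s ⊩ φ = Forcing._⊩_ (ColouredTree.transitionSystem T) (ColouredTree.colouring T) s φ

{-# OPTIONS --safe #-}
module Submission where

-- The model is a tableau.  A type decides every formula in the closure Γ of φ₀,
-- and so names an element of the algebra, the meet of its literals; call an
-- element null if it is ≈ ⊥.  Only ¬ (φ₀ ≈ ⊥) is given, and being null is
-- undecidable, so consistent types cannot be selected.  Instead, all members of
-- a finite set of states are present at first, and states are eliminated as long
-- as possible, where only states whose element is null are ever eliminated.  If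
-- no initial state containing φ₀ survived, φ₀ would be null.  The surviving
-- states satisfy all local conditions, have the successors that they demand, and
-- for every EU- and EG-formula a finite path to the target of the former, and to a
-- node where the second argument of the latter holds (null-or-good,
-- null-or-reaches); the model is built from them.
--
-- The difficulty is to keep branches from satisfying EG α β where this formula is
-- false.  The key is the induction principle no-return: if u is non-null, below
-- α, and disjoint from EG α β, then so is some part of u after which no α-path
-- meets β and later returns to u.  Hence a branch may record types to which it
-- will not return as long as α holds.  There are finitely many types, so β can be
-- met only finitely often, provided that records are not lost.  To protect
-- several EG-formulas at once, the records form a list in order of priority, and
-- the record of each formula is made relative to those of higher priority.  A
-- change at one position resets the positions behind it, and a formula EG α β is
-- moved to the end once α fails (or EG α β holds).  Along a branch that satisfies
-- α throughout and never EG α β, the part of the list up to the record of EG α β,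
-- read as a number with the highest priority first, never increases, and it
-- decreases for each new record (update-measure, fire-measure).
--
-- Making a record replaces an element by a non-null part, whereas the finite paths
-- for EU and EG exist only if the whole of each element is considered.  So there
-- are two kinds of steps: lazy ones, which note that β was met but record nothing
-- (update-covers), and strict ones, which make a record (fire-null).  A node of
-- the model carries a state and a plan, a finite lazy path; its children either
-- follow the plan or are reached by a strict step and adopt any new plan.  The tree
-- is the unravelling of this graph.  Each finite path required by EU or EG is a
-- strict step followed by a plan, while an infinite branch takes infinitely many
-- strict steps, so the measure above rules out that it satisfies a false EG-formula.

open import Defs
import Algebra.Lattice.Properties.BooleanAlgebra as BooleanAlgebraProperties
open import Data.Bool.Base using (Bool; true; false; not; if_then_else_)
  renaming (_∧_ to _&&_; _∨_ to _||_)
open import Data.Bool.Properties using () renaming (∨-zeroʳ to ||-zeroʳ)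
open import Data.Empty using (⊥; ⊥-elim)
open import Data.Fin.Base using (Fin; zero; suc)
open import Data.Fin.Subset as Subset using (Subset; ⁅_⁆; _∪_; ∣_∣)
import Data.Fin.Subset.Properties as Subset
open import Data.List.Base as List using (List; []; _∷_; [_]; _++_; _∷ʳ_)
import Data.List.Properties as List
open import Data.List.Membership.Propositional using (_∈_)
open import Data.List.Membership.Propositional.Properties
  using (∈-map⁺; ∈-map⁻; ∈-++⁺ˡ; ∈-++⁺ʳ; ∈-++⁻; ∈-allFin; ∈-cartesianProductWith⁺)
open import Data.List.Relation.Unary.All as All using (All; []; _∷_)
open import Data.List.Relation.Unary.Any as Any using (here; there)
open import Data.List.Relation.Unary.Any.Properties using (lookup-index)
open import Data.Maybe.Base as Maybe using (Maybe; just; nothing)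
open import Data.Nat.Base hiding (_⊔_)
open import Data.Nat.Induction using (<-wellFounded)
open import Data.Nat.Properties
open import Data.Product.Base using (Σ; ∃; ∃-syntax; _×_; _,_; proj₁; proj₂)
open import Data.Sum.Base using (_⊎_; inj₁; inj₂; [_,_]′)
open import Data.Unit.Base using (⊤; tt)
open import Data.Vec.Base as Vec using (Vec; []; _∷_)
open import Data.Vec.Properties using ([]=⇒lookup; lookup⇒[]=; lookup∘tabulate)
import Data.Vec.Relation.Unary.All as Vec∀
import Data.Vec.Relation.Unary.Any as Vec∃
open import Function.Base using (_∘_)
open import Induction.WellFounded using (Acc; acc)
open import Level using (Level; _⊔_)
open import Relation.Binary.Construct.Closure.ReflexiveTransitive using (Star; ε; _◅_; _◅◅_)
open import Relation.Binary.PropositionalEquality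
  using (_≡_; refl; sym; trans; cong; cong₂; subst; module ≡-Reasoning)
open import Relation.Nullary.Negation.Core using (¬_)

private
  variable
    ℓ₁ ℓ₂ ℓ₃ ℓ₄ : Level

-- Searching and saturating finite sets

-- A finite set is given by a list of all its elements, possibly with
-- repetitions.
record Listed (A : Set ℓ₁) : Set ℓ₁ where
  field
    elements : List A
    complete : ∀ x → x ∈ elements

open Listed

listedFin : ∀ n → Listed (Fin n)
listedFin n = record { elements = List.allFin n ; complete = ∈-allFin }

listedBool : Listed Bool
listedBool = record
  { elements = true ∷ false ∷ []
  ; complete = λ { true → here refl ; false → there (here refl) }
  }

listed× : {A : Set ℓ₁} {B : Set ℓ₂} → Listed A → Listed B → Listed (A × B)
listed× lA lB = record
  { elements = List.cartesianProductWith _,_ (elements lA) (elements lB)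
  ; complete = λ (x , y) → ∈-cartesianProductWith⁺ _,_ (complete lA x) (complete lB y)
  }

listedVec : {A : Set ℓ₁} → Listed A → ∀ k → Listed (Vec A k)
listedVec lA zero    = record { elements = [ [] ] ; complete = λ { [] → here refl } }
listedVec lA (suc k) = record
  { elements = List.cartesianProductWith _∷_ (elements lA) (elements (listedVec lA k))
  ; complete = λ { (x ∷ xs) →
      ∈-cartesianProductWith⁺ _∷_ (complete lA x) (complete (listedVec lA k) xs) }
  }

listedImage : {A : Set ℓ₁} {B : Set ℓ₂} (f : A → B) (g : B → A) → (∀ y → f (g y) ≡ y) →
              Listed A → Listed B
listedImage f g fg lA = record
  { elements = List.map f (elements lA)
  ; complete = λ y → subst (_∈ _) (fg y) (∈-map⁺ f (complete lA (g y)))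
  }

all⊎any : {A : Set ℓ₁} {P : A → Set ℓ₃} {Q : A → Set ℓ₄} → Listed A →
          (∀ x → P x ⊎ Q x) → (∀ x → P x) ⊎ ∃ Q
all⊎any {P = P} {Q} lA dich with All.decide dich (elements lA)
... | inj₁ ps = inj₁ λ x → All.lookup ps (complete lA x)
... | inj₂ qs = inj₂ (Any.satisfied qs)

-- The same over the positions of a list, with a fixed alternative.
alternative⊎all : {A : Set ℓ₁} {Q : Set ℓ₃} (xs : List A) (P : ∀ x → x ∈ xs → Set ℓ₄) →
                  (∀ x (i : x ∈ xs) → Q ⊎ P x i) → Q ⊎ (∀ x (i : x ∈ xs) → P x i)
alternative⊎all []       P dich = inj₂ λ x ()
alternative⊎all (y ∷ xs) P dich
  with dich y (here refl) | alternative⊎all xs (λ x i → P x (there i)) (λ x i → dich x (there i))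
... | inj₁ z | _      = inj₁ z
... | inj₂ _ | inj₁ z = inj₁ z
... | inj₂ p | inj₂ f = inj₂ λ { _ (here refl) → p ; x (there i) → f x i }

-- The number of entries of a list outside S.
misses : {A : Set ℓ₁} → (A → Bool) → List A → ℕ
misses S []       = 0
misses S (x ∷ xs) = (if S x then 0 else 1) + misses S xs

private
  if-≤ : ∀ {s s′} → (s ≡ true → s′ ≡ true) → (if s′ then 0 else 1) ≤ (if s then 0 else 1)
  if-≤ {true}  {true}  _ = z≤n
  if-≤ {true}  {false} h with h refl
  ... | ()
  if-≤ {false} {true}  _ = z≤n
  if-≤ {false} {false} _ = ≤-refl

misses-≤ : {A : Set ℓ₁} {S S′ : A → Bool} → (∀ x → S x ≡ true → S′ x ≡ true) →
           ∀ xs → misses S′ xs ≤ misses S xs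
misses-≤ S⊆S′ []       = z≤n
misses-≤ S⊆S′ (x ∷ xs) = +-mono-≤ (if-≤ (S⊆S′ x)) (misses-≤ S⊆S′ xs)

misses-< : {A : Set ℓ₁} {S S′ : A → Bool} → (∀ x → S x ≡ true → S′ x ≡ true) →
           ∀ {x xs} → x ∈ xs → S x ≡ false → S′ x ≡ true → misses S′ xs < misses S xs
misses-< S⊆S′ {x} {_ ∷ xs} (here refl) x∉S x∈S′ rewrite x∉S | x∈S′ = s≤s (misses-≤ S⊆S′ xs)
misses-< S⊆S′ {x} {y ∷ xs} (there i)   x∉S x∈S′ =
  +-mono-≤-< (if-≤ (S⊆S′ y)) (misses-< S⊆S′ i x∉S x∈S′)

-- Saturation.  Suppose that, relative to any set S of points satisfying Q,
-- each point satisfies Q or is R-blocked by S.  Then there is a set S of points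
-- satisfying Q such that every point outside S is R-blocked by S itself: add
-- points as long as possible.
saturate : {A : Set ℓ₁} → Listed A → (Q : A → Set ℓ₃) (R : (A → Bool) → A → Set ℓ₄) →
           (∀ S → (∀ x → S x ≡ true → Q x) → ∀ x → Q x ⊎ R S x) →
           ∃[ S ] (∀ x → S x ≡ true → Q x) × (∀ x → S x ≡ false → R S x)
saturate {A = A} lA Q R step = grow (λ _ → false) (λ x ()) (<-wellFounded _)
  where
  grow : ∀ S → (∀ x → S x ≡ true → Q x) → Acc _<_ (misses S (elements lA)) →
         ∃[ S′ ] (∀ x → S′ x ≡ true → Q x) × (∀ x → S′ x ≡ false → R S′ x)
  grow S sound (acc rec) = result (all⊎any lA dich)
    where
    -- The points that one round adds are those whose step succeeds.
    added : A → Bool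
    added x = [ (λ _ → true) , (λ _ → false) ]′ (step S sound x)

    dich : ∀ x → (S x ≡ false → R S x) ⊎ (S x ≡ false × added x ≡ true)
    dich x with S x | step S sound x
    ... | true  | _      = inj₁ λ ()
    ... | false | inj₁ _ = inj₂ (refl , refl)
    ... | false | inj₂ s = inj₁ λ _ → s

    S⁺ : A → Bool
    S⁺ x = S x || added x

    sound⁺ : ∀ x → S⁺ x ≡ true → Q x
    sound⁺ x e with S x in eq | step S sound x | e
    ... | true  | _      | _  = sound x eq
    ... | false | inj₁ p | _  = p
    ... | false | inj₂ _ | ()

    S⊆S⁺ : ∀ x → S x ≡ true → S⁺ x ≡ true
    S⊆S⁺ x e rewrite e = refl

    result : (∀ x → S x ≡ false → R S x) ⊎ ∃ (λ x → S x ≡ false × added x ≡ true) →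
             ∃[ S′ ] (∀ x → S′ x ≡ true → Q x) × (∀ x → S′ x ≡ false → R S′ x)
    result (inj₁ blocked)         = S , sound , blocked
    result (inj₂ (x , x∉S , new)) =
      grow S⁺ sound⁺ (rec (misses-< S⊆S⁺ (complete lA x) x∉S
                            (trans (cong (_|| added x) x∉S) new)))

-- Temporal algebras

-- The temporal and Boolean laws in terms of the order.  Boolean reasoning is
-- done in the style of natural deduction, reading x ≼ y as "y follows from x".
module TemporalAlgebra {c ℓ} (𝔸 : CTLᶠ-Algebra c ℓ) where

  open CTLᶠ-Algebra 𝔸 public
    using (Carrier; _≈_; _∨_; _∧_; ¬ᴬ_; ⊤ᴬ; ⊥ᴬ; ◇; EU; EG; _≼_)
  open CTLᶠ-Algebra 𝔸
    using ( ◇-cong; ◇-⊥; ◇-∨; ◇-⊤; EU-lpf; EG-gpf; booleanAlgebra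
          ; ∨-assoc; ∨-comm; ∨-congˡ; ∨-congʳ; ∨-absorbs-∧; ∨-distribˡ-∧; ∧-distribˡ-∨
          ; ∧-comm; ∨-complementʳ; ∧-complementʳ)
    renaming (sym to ≈-sym; trans to ≈-trans)
  open BooleanAlgebraProperties booleanAlgebra
    using (∨-idem; ∨-zeroʳ; ∨-identityˡ; ∨-identityʳ)

  private
    variable
      s u w x y z : Carrier

  abstract

    ≼-reflexive : x ≈ y → x ≼ y
    ≼-reflexive x≈y = ≈-trans (∨-congʳ x≈y) (∨-idem _)

    ≼-refl : x ≼ x
    ≼-refl = ∨-idem _

    ≼-trans : x ≼ y → y ≼ z → x ≼ z
    ≼-trans x≼y y≼z =
      ≈-trans (∨-congˡ (≈-sym y≼z)) (≈-trans (≈-sym (∨-assoc _ _ _)) (≈-trans (∨-congʳ x≼y) y≼z))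

    inl : x ≼ x ∨ y
    inl = ≈-trans (≈-sym (∨-assoc _ _ _)) (∨-congʳ (∨-idem _))

    inr : y ≼ x ∨ y
    inr = ≼-trans inl (≼-reflexive (∨-comm _ _))

    ∨-lub : x ≼ z → y ≼ z → x ∨ y ≼ z
    ∨-lub x≼z y≼z = ≈-trans (∨-assoc _ _ _) (≈-trans (∨-congˡ y≼z) x≼z)

    fst : x ∧ y ≼ x
    fst = ≈-trans (∨-comm _ _) (∨-absorbs-∧ _ _)

    snd : x ∧ y ≼ y
    snd = ≼-trans (≼-reflexive (∧-comm _ _)) fst

    ∧-glb : z ≼ x → z ≼ y → z ≼ x ∧ y
    ∧-glb z≼x z≼y = ≈-trans (∨-distribˡ-∧ _ _ _) (CTLᶠ-Algebra.∧-cong 𝔸 z≼x z≼y)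

    ∧-mono : x ≼ y → w ≼ z → x ∧ w ≼ y ∧ z
    ∧-mono x≼y w≼z = ∧-glb (≼-trans fst x≼y) (≼-trans snd w≼z)

    ⊥-least : ⊥ᴬ ≼ x
    ⊥-least = ∨-identityˡ _

    ⊤-greatest : x ≼ ⊤ᴬ
    ⊤-greatest = ∨-zeroʳ _

  -- Null elements play the part of inconsistent ones.
  Null : Carrier → Set ℓ
  Null x = x ≼ ⊥ᴬ

  abstract

    null⇒≈⊥ : Null x → x ≈ ⊥ᴬ
    null⇒≈⊥ x≼⊥ = ≈-trans (≈-sym (∨-identityʳ _)) x≼⊥

    by-cases : w ≼ x ∨ y → w ∧ x ≼ z → w ∧ y ≼ z → w ≼ z
    by-cases w≼x∨y l r =
      ≼-trans (∧-glb ≼-refl w≼x∨y) (≼-trans (≼-reflexive (∧-distribˡ-∨ _ _ _)) (∨-lub l r))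

    excluded-middle : w ≼ x ∨ (¬ᴬ x)
    excluded-middle = ≼-trans ⊤-greatest (≼-reflexive (≈-sym (∨-complementʳ _)))

    contradiction : w ≼ x → w ≼ ¬ᴬ x → w ≼ z
    contradiction p q = ≼-trans (∧-glb p q) (≼-trans (≼-reflexive (∧-complementʳ _)) ⊥-least)

    ¬-intro : Null (w ∧ x) → w ≼ ¬ᴬ x
    ¬-intro p = by-cases excluded-middle (≼-trans p ⊥-least) snd

    by-contradiction : Null (w ∧ (¬ᴬ x)) → w ≼ x
    by-contradiction p = by-cases excluded-middle snd (≼-trans p ⊥-least)

    ¬-elim : w ≼ ¬ᴬ x → Null (w ∧ x)
    ¬-elim p = contradiction snd (≼-trans fst p)

    ¬¬-elim : ¬ᴬ (¬ᴬ x) ≼ x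
    ¬¬-elim = by-contradiction (contradiction snd fst)

    ¬-antitone : x ≼ y → ¬ᴬ y ≼ ¬ᴬ x
    ¬-antitone p = ¬-intro (contradiction (≼-trans snd p) fst)

  module _ {I : Set ℓ₁} (P : I → Bool) (f : I → Carrier) where

    -- The join of the f i with i in a list and P i.
    ⋁ : List I → Carrier
    ⋁ []       = ⊥ᴬ
    ⋁ (i ∷ is) = (if P i then f i else ⊥ᴬ) ∨ ⋁ is

    abstract

      ⋁-upper : ∀ {i is} → i ∈ is → P i ≡ true → f i ≼ ⋁ is
      ⋁-upper {i} {_ ∷ is} (here refl) Pi rewrite Pi = inl
      ⋁-upper (there j) Pi = ≼-trans (⋁-upper j Pi) inr

      ⋁-least : ∀ is → (∀ i → P i ≡ true → f i ≼ x) → ⋁ is ≼ x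
      ⋁-least []       h = ⊥-least
      ⋁-least (i ∷ is) h with P i in Pi
      ... | true  = ∨-lub (h i Pi) (⋁-least is h)
      ... | false = ∨-lub ⊥-least (⋁-least is h)

  abstract

    ◇-mono : x ≼ y → ◇ x ≼ ◇ y
    ◇-mono x≼y = ≈-trans (≈-sym (◇-∨ _ _)) (◇-cong x≼y)

    ◇-∨-split : ◇ (x ∨ y) ≼ ◇ x ∨ ◇ y
    ◇-∨-split = ≼-reflexive (◇-∨ _ _)

    ◇-null : Null x → Null (◇ x)
    ◇-null p = ≼-trans (◇-mono p) (≼-reflexive ◇-⊥)

    ⊤≼◇⊤ : w ≼ ◇ ⊤ᴬ
    ⊤≼◇⊤ = ≼-trans ⊤-greatest (≼-reflexive (≈-sym ◇-⊤))

  □ : Carrier → Carrier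
  □ x = ¬ᴬ ◇ (¬ᴬ x)

  abstract

    □-mono : x ≼ y → □ x ≼ □ y
    □-mono p = ¬-antitone (◇-mono (¬-antitone p))

    □-⊤ : w ≼ □ ⊤ᴬ
    □-⊤ = ¬-intro (≼-trans snd (◇-null (contradiction ⊤-greatest ≼-refl)))

    □-◇ : □ x ∧ ◇ y ≼ ◇ (x ∧ y)
    □-◇ = by-cases (≼-trans snd (≼-trans (◇-mono split) ◇-∨-split))
            snd (contradiction snd (≼-trans fst fst))
      where
      split : y ≼ (x ∧ y) ∨ (¬ᴬ x)
      split = by-cases excluded-middle
                (≼-trans (∧-glb snd fst) inl) (≼-trans snd inr)

    □-glb : w ≼ □ x → w ≼ □ y → w ≼ □ (x ∧ y)
    □-glb p q = ¬-intro (by-cases (≼-trans snd (≼-trans (◇-mono deMorgan) ◇-∨-split))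
                          (contradiction snd (≼-trans fst (≼-trans fst p)))
                          (contradiction snd (≼-trans fst (≼-trans fst q))))
      where
      deMorgan : ¬ᴬ (x ∧ y) ≼ (¬ᴬ x) ∨ (¬ᴬ y)
      deMorgan = by-cases excluded-middle
                   (≼-trans (¬-intro (contradiction (∧-glb (≼-trans fst snd) snd)
                                       (≼-trans fst fst)))
                            inr)
                   (≼-trans snd inl)

    EU-here : x ≼ EU x y
    EU-here = ≼-trans inl (proj₁ (EU-lpf _ _))

    EU-next : y ∧ ◇ (EU x y) ≼ EU x y
    EU-next = ≼-trans inr (proj₁ (EU-lpf _ _))

    EU-least : x ≼ z → y ∧ ◇ z ≼ z → EU x y ≼ z
    EU-least p q = proj₂ (EU-lpf _ _) _ (∨-lub p q)

    EU-mono : w ≼ x → EU w y ≼ EU x y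
    EU-mono p = EU-least (≼-trans p EU-here) EU-next

    EU-null : Null x → Null (EU x y)
    EU-null p = EU-least p (≼-trans snd (≼-reflexive ◇-⊥))

    EU-unfold : EU x y ≼ x ∨ (y ∧ ◇ (EU x y))
    EU-unfold {x} {y} = EU-least inl (≼-trans (∧-mono ≼-refl (◇-mono fold)) inr)
      where
      fold : x ∨ (y ∧ ◇ (EU x y)) ≼ EU x y
      fold = proj₁ (EU-lpf _ _)

    -- A condition s that persists along y-steps also holds at the target.
    EU-persistent : s ∧ y ≼ □ s → s ∧ EU x y ≼ EU (x ∧ s) y
    EU-persistent {s} {y} {x} stays =
      by-cases (≼-trans snd (EU-least here⁺ next⁺)) (contradiction (≼-trans fst fst) snd) snd
      where
      here⁺ : x ≼ (¬ᴬ s) ∨ EU (x ∧ s) y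
      here⁺ = by-cases excluded-middle (≼-trans EU-here inr) (≼-trans snd inl)

      next⁺ : y ∧ ◇ ((¬ᴬ s) ∨ EU (x ∧ s) y) ≼ (¬ᴬ s) ∨ EU (x ∧ s) y
      next⁺ = by-cases (≼-trans snd ◇-∨-split)
        (≼-trans (¬-intro (contradiction (≼-trans fst snd)
                            (≼-trans (∧-glb snd (≼-trans fst (≼-trans fst fst))) stays)))
                 inl)
        (≼-trans (∧-mono fst ≼-refl) (≼-trans EU-next inr))

    EG-holds : EG x y ≼ x
    EG-holds = ≼-trans (proj₁ (EG-gpf _ _)) fst

    EG-returns : EG x y ≼ ◇ (EU (y ∧ EG x y) x)
    EG-returns = ≼-trans (proj₁ (EG-gpf _ _)) snd

    EG-greatest : z ≼ x → z ≼ ◇ (EU (y ∧ z) x) → z ≼ EG x y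
    EG-greatest p q = proj₂ (EG-gpf _ _) _ (∧-glb p q)

    EG-reaches : EG x y ≼ EU (y ∧ EG x y) x
    EG-reaches = ≼-trans (∧-glb EG-holds EG-returns) EU-next

    EG-prepend : x ∧ ◇ (EG x y) ≼ EG x y
    EG-prepend {x} {y} = ≼-trans inr (EG-greatest (∨-lub EG-holds fst)
      (∨-lub (≼-trans EG-returns weaken)
             (≼-trans snd (≼-trans (◇-mono EG-reaches) weaken))))
      where
      weaken : ◇ (EU (y ∧ EG x y) x) ≼ ◇ (EU (y ∧ (EG x y ∨ (x ∧ ◇ (EG x y)))) x)
      weaken = ◇-mono (EU-mono (∧-mono ≼-refl inl))

    EG-continues : EG x y ≼ ◇ (EG x y)
    EG-continues = ≼-trans EG-returns (◇-mono (EU-least snd EG-prepend))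

    -- The induction principle for the negation of EG: a non-null u below x and
    -- disjoint from EG x y has a non-null part after which no x-path meets y and
    -- later u.  Otherwise EU u x would be a post-fixpoint and lie below EG x y.
    no-return : u ≼ x → Null (u ∧ EG x y) → u ≼ ◇ (EU (y ∧ EU u x) x) → Null u
    no-return {u} {x} {y} u≼x disjoint returns =
      ≼-trans (∧-glb ≼-refl (≼-trans EU-here below)) disjoint
      where
      r : Carrier
      r = x ∧ ◇ (EU (y ∧ EU u x) x)

      all-return : EU u x ≼ r
      all-return = EU-least (∧-glb u≼x returns)
        (∧-mono ≼-refl (◇-mono EU-next))

      below : EU u x ≼ EG x y
      below = EG-greatest (≼-trans all-return fst) (≼-trans all-return snd)

-- Watch lists

-- The bookkeeping that keeps branches from satisfying EG-formulas that they are
-- required to refute.  The elements of X stand for the EG-formulas EG α β of the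
-- closure and Fin N for the types: alive e v says that α belongs to the type v
-- and EG α β does not, and meets e v says that β belongs to v.
module Watching {X : Set} {N : ℕ} (alive meets : X → Fin N → Bool) where

  -- A watch for EG α β records types to which the branch will not return while α
  -- holds and the promises of the watches of higher priority are kept: not at all
  -- if the watch is armed, and not after the next β-node otherwise.
  record Watch : Set where
    constructor watch
    field
      watched : X
      barred  : Subset N
      armed   : Bool

  open Watch public

  fresh arm : Watch → Watch
  fresh (watch e F _) = watch e Subset.⊥ false
  arm   (watch e F _) = watch e F true

  bar : Fin N → Watch → Watch
  bar v (watch e F _) = watch e (F ∪ ⁅ v ⁆) false

  -- Passing to a node of type v.  The list is in order of decreasing priority,
  -- and the first watch affected resets all those behind it.  A watch that is no
  -- longer alive goes to the end of the list.
  update : Fin N → ∀ {k} → Vec Watch k → Vec Watch k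
  update v [] = []
  update v (x ∷ L) with alive (watched x) v | armed x || not (meets (watched x) v)
  ... | false | _     = Vec.map fresh L Vec.∷ʳ fresh x
  ... | true  | true  = x ∷ update v L
  ... | true  | false = arm x ∷ Vec.map fresh L

  -- Adding the type v to the first armed watch, if there is one, and resetting the
  -- watches behind it; this fails if v is already barred there.
  fire : Fin N → ∀ {k} → Vec Watch k → Maybe (Vec Watch k)
  fire v [] = just []
  fire v (x ∷ L) with armed x | Vec.lookup (barred x) v
  ... | true  | true  = nothing
  ... | true  | false = just (bar v x ∷ Vec.map fresh L)
  ... | false | _     = Maybe.map (x ∷_) (fire v L)

  -- Each watch in an updated list is alive at v or fresh; in particular the armed
  -- ones are alive.
  Settled : Fin N → Watch → Set
  Settled v x = alive (watched x) v ≡ true ⊎ x ≡ fresh x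

  map-fresh-fresh : ∀ {k} (L : Vec Watch k) → Vec∀.All (λ x → x ≡ fresh x) (Vec.map fresh L)
  map-fresh-fresh []      = Vec∀.[]
  map-fresh-fresh (x ∷ L) = refl Vec∀.∷ map-fresh-fresh L

  ∷ʳ-fresh : ∀ {k} {L : Vec Watch k} x → Vec∀.All (λ y → y ≡ fresh y) L →
             Vec∀.All (λ y → y ≡ fresh y) (L Vec.∷ʳ fresh x)
  ∷ʳ-fresh x Vec∀.[]       = refl Vec∀.∷ Vec∀.[]
  ∷ʳ-fresh x (p Vec∀.∷ ps) = p Vec∀.∷ ∷ʳ-fresh x ps

  update-settled : ∀ v {k} (L : Vec Watch k) → Vec∀.All (Settled v) (update v L)
  update-settled v [] = Vec∀.[]
  update-settled v (x ∷ L)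
    with alive (watched x) v in al | armed x || not (meets (watched x) v)
  ... | false | _     = Vec∀.map inj₂ (∷ʳ-fresh x (map-fresh-fresh L))
  ... | true  | true  = inj₁ al Vec∀.∷ update-settled v L
  ... | true  | false = inj₁ al Vec∀.∷ Vec∀.map inj₂ (map-fresh-fresh L)

  -- An occurrence of a watch for e.
  _∈ʷ_ : X → ∀ {k} → Vec Watch k → Set
  e ∈ʷ L = Vec∃.Any (λ x → watched x ≡ e) L

  freshen : ∀ {e k} {L : Vec Watch k} → e ∈ʷ L → e ∈ʷ Vec.map fresh L
  freshen (Vec∃.here px) = Vec∃.here px
  freshen (Vec∃.there m) = Vec∃.there (freshen m)

  snoc-old : ∀ {e k} {L : Vec Watch k} {x} → e ∈ʷ L → e ∈ʷ (L Vec.∷ʳ x)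
  snoc-old (Vec∃.here px) = Vec∃.here px
  snoc-old (Vec∃.there m) = Vec∃.there (snoc-old m)

  snoc-new : ∀ {e k} (L : Vec Watch k) {x} → watched x ≡ e → e ∈ʷ (L Vec.∷ʳ x)
  snoc-new []      px = Vec∃.here px
  snoc-new (y ∷ L) px = Vec∃.there (snoc-new L px)

  update-keeps : ∀ {e} v {k} {L : Vec Watch k} → e ∈ʷ L → e ∈ʷ update v L
  update-keeps v {L = x ∷ L} m
    with alive (watched x) v | armed x || not (meets (watched x) v) | m
  ... | false | _     | Vec∃.here px = snoc-new (Vec.map fresh L) px
  ... | false | _     | Vec∃.there i = snoc-old (freshen i)
  ... | true  | true  | Vec∃.here px = Vec∃.here px
  ... | true  | true  | Vec∃.there i = Vec∃.there (update-keeps v i)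
  ... | true  | false | Vec∃.here px = Vec∃.here px
  ... | true  | false | Vec∃.there i = Vec∃.there (freshen i)

  -- A number that decreases whenever a watch is armed, or an armed watch is fired
  -- at a type not yet barred.
  weight : Watch → ℕ
  weight (watch _ F f) = suc (2 * (N ∸ ∣ F ∣) + (if f then 0 else 1))

  base : ℕ
  base = 3 + 2 * N

  weight<base : ∀ x → weight x < base
  weight<base (watch _ F f) = s≤s (s≤s (begin
    2 * (N ∸ ∣ F ∣) + (if f then 0 else 1) ≤⟨ +-mono-≤ (*-monoʳ-≤ 2 (m∸n≤m N ∣ F ∣)) (bit f) ⟩
    2 * N + 1                              ≡⟨ +-comm (2 * N) 1 ⟩
    1 + 2 * N                              ∎))
    where
    open ≤-Reasoning
    bit : ∀ f → (if f then 0 else 1) ≤ 1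
    bit true  = z≤n
    bit false = ≤-refl

  -- The weights up to the given occurrence, read as the digits of a number with
  -- the most significant one at the head of the list; capacity is the
  -- corresponding power of the base.  As no digit is zero, a shorter number is
  -- smaller.
  capacity measure : ∀ {e k} {L : Vec Watch k} → e ∈ʷ L → ℕ
  capacity (Vec∃.here _)  = base
  capacity (Vec∃.there m) = base * capacity m
  measure (Vec∃.here {x = x} _)  = weight x
  measure (Vec∃.there {x = x} m) = weight x * capacity m + measure m

  measure<capacity : ∀ {e k} {L : Vec Watch k} (m : e ∈ʷ L) → measure m < capacity m
  measure<capacity (Vec∃.here {x = x} _)  = weight<base x
  measure<capacity (Vec∃.there {x = x} m) = begin-strict
    weight x * capacity m + measure m  <⟨ +-monoʳ-< (weight x * capacity m) (measure<capacity m) ⟩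
    weight x * capacity m + capacity m ≡⟨ +-comm (weight x * capacity m) (capacity m) ⟩
    suc (weight x) * capacity m        ≤⟨ *-monoˡ-≤ (capacity m) (weight<base x) ⟩
    base * capacity m                  ∎
    where open ≤-Reasoning

  capacity-freshen : ∀ {e k} {L : Vec Watch k} (m : e ∈ʷ L) → capacity (freshen m) ≡ capacity m
  capacity-freshen (Vec∃.here _)  = refl
  capacity-freshen (Vec∃.there m) = cong (base *_) (capacity-freshen m)

  capacity-snoc : ∀ {e k} {L : Vec Watch k} {x} (m : e ∈ʷ L) →
                  capacity (snoc-old {x = x} m) ≡ capacity m
  capacity-snoc (Vec∃.here _)  = refl
  capacity-snoc (Vec∃.there m) = cong (base *_) (capacity-snoc m)

  digit-drops : ∀ {w w′ c c′ d d′} → w′ < w → c′ ≤ c → d′ < c′ → w′ * c′ + d′ < w * c + d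
  digit-drops {w} {w′} {c} {c′} {d} {d′} w′<w c′≤c d′<c′ = begin-strict
    w′ * c′ + d′ <⟨ +-monoʳ-< (w′ * c′) d′<c′ ⟩
    w′ * c′ + c′ ≡⟨ +-comm (w′ * c′) c′ ⟩
    suc w′ * c′  ≤⟨ *-mono-≤ w′<w c′≤c ⟩
    w * c        ≤⟨ m≤m+n (w * c) d ⟩
    w * c + d    ∎
    where open ≤-Reasoning

  weight-arm : ∀ x → armed x ≡ false → weight (arm x) < weight x
  weight-arm (watch e F false) refl = s≤s (+-monoʳ-< (2 * (N ∸ ∣ F ∣)) (s≤s z≤n))

  weight-bar : ∀ v x → armed x ≡ true → Vec.lookup (barred x) v ≡ false →
               weight (bar v x) < weight x
  weight-bar v (watch e F true) refl v∉F = s≤s (begin-strict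
    2 * (N ∸ ∣ F ∪ ⁅ v ⁆ ∣) + 1   ≡⟨ +-comm _ 1 ⟩
    1 + 2 * (N ∸ ∣ F ∪ ⁅ v ⁆ ∣)   <⟨ n<1+n _ ⟩
    2 + 2 * (N ∸ ∣ F ∪ ⁅ v ⁆ ∣)   ≡⟨ sym (*-suc 2 _) ⟩
    2 * suc (N ∸ ∣ F ∪ ⁅ v ⁆ ∣)   ≤⟨ *-monoʳ-≤ 2 (∸-monoʳ-< grows (Subset.∣p∣≤n (F ∪ ⁅ v ⁆))) ⟩
    2 * (N ∸ ∣ F ∣)               ≡⟨ sym (+-identityʳ _) ⟩
    2 * (N ∸ ∣ F ∣) + 0           ∎)
    where
    open ≤-Reasoning
    grows : ∣ F ∣ < ∣ F ∪ ⁅ v ⁆ ∣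
    grows = Subset.p⊂q⇒∣p∣<∣q∣ {p = F} {F ∪ ⁅ v ⁆}
      ( Subset.p⊆p∪q {p = F} ⁅ v ⁆
      , v , Subset.x∈p∪q⁺ {p = F} (inj₂ (Subset.x∈⁅x⁆ v))
      , λ v∈F → false≢true (trans (sym v∉F) ([]=⇒lookup v∈F)))
      where
      false≢true : ¬ (false ≡ true)
      false≢true ()

  armedAt : ∀ {e k} {L : Vec Watch k} → e ∈ʷ L → Bool
  armedAt (Vec∃.here {x = x} _) = armed x
  armedAt (Vec∃.there m)        = armedAt m

  ||-falseˡ : ∀ {f g} → f || g ≡ false → f ≡ false
  ||-falseˡ {false} _ = refl

  -- As long as e stays alive, an update does not increase the measure of its
  -- watch; the measure only stays the same if the watch is armed afterwards
  -- whenever it was armed before or the new node meets e.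
  update-measure : ∀ {e} v → alive e v ≡ true → ∀ {k} {L : Vec Watch k} (m : e ∈ʷ L) →
    ∃ λ (m′ : e ∈ʷ update v L) → capacity m′ ≤ capacity m ×
      (measure m′ < measure m ⊎
       (capacity m′ ≡ capacity m × measure m′ ≡ measure m × armedAt m′ ≡ armedAt m || meets e v))
  update-measure {e} v al {L = x ∷ L} m
    with alive (watched x) v in alx | armed x || not (meets (watched x) v) in am | m
  ... | false | _     | Vec∃.here refl with trans (sym alx) al
  ...   | ()
  update-measure {e} v al {L = x ∷ L} m | false | _ | Vec∃.there i =
    snoc-old (freshen i) , same-capacity≤ , inj₁ (begin-strict
      measure (snoc-old (freshen i))    <⟨ measure<capacity (snoc-old (freshen i)) ⟩
      capacity (snoc-old (freshen i))   ≡⟨ same-capacity ⟩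
      capacity i                        ≤⟨ m≤m+n (capacity i) _ ⟩
      weight x * capacity i             ≤⟨ m≤m+n (weight x * capacity i) (measure i) ⟩
      weight x * capacity i + measure i ∎)
    where
    open ≤-Reasoning
    same-capacity : capacity (snoc-old {x = fresh x} (freshen i)) ≡ capacity i
    same-capacity = trans (capacity-snoc (freshen i)) (capacity-freshen i)

    same-capacity≤ : capacity (snoc-old {x = fresh x} (freshen i)) ≤ base * capacity i
    same-capacity≤ = ≤-trans (≤-reflexive same-capacity) (m≤m+n (capacity i) _)
  update-measure {e} v al {L = x ∷ L} m | true | true | Vec∃.here refl =
    Vec∃.here refl , ≤-refl , inj₂ (refl , refl , unchanged (armed x) _ am)
    where
    unchanged : ∀ f g → f || not g ≡ true → f ≡ f || g
    unchanged true  g     _ = refl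
    unchanged false false _ = refl
  update-measure {e} v al {L = x ∷ L} m | true | true | Vec∃.there i
    with update-measure v al i
  ... | i′ , c≤ , inj₁ μ<            =
    Vec∃.there i′ , *-monoʳ-≤ base c≤ , inj₁ (+-mono-≤-< (*-monoʳ-≤ (weight x) c≤) μ<)
  ... | i′ , c≤ , inj₂ (c≡ , μ≡ , f) =
    Vec∃.there i′ , *-monoʳ-≤ base c≤ ,
    inj₂ (cong (base *_) c≡ , cong₂ _+_ (cong (weight x *_) c≡) μ≡ , f)
  update-measure {e} v al {L = x ∷ L} m | true | false | Vec∃.here refl =
    Vec∃.here refl , ≤-refl , inj₁ (weight-arm x (||-falseˡ am))
  update-measure {e} v al {L = x ∷ L} m | true | false | Vec∃.there i =
    Vec∃.there (freshen i) , *-monoʳ-≤ base (≤-reflexive (capacity-freshen i)) ,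
    inj₁ (digit-drops (weight-arm x (||-falseˡ am)) (≤-reflexive (capacity-freshen i))
            (measure<capacity (freshen i)))

  -- Firing does not increase the measure, and decreases it if the watch was armed.
  fire-measure : ∀ {e} v {k} {L L′ : Vec Watch k} → fire v L ≡ just L′ → (m : e ∈ʷ L) →
    ∃ λ (m′ : e ∈ʷ L′) → capacity m′ ≡ capacity m ×
      (measure m′ < measure m ⊎ (measure m′ ≡ measure m × armedAt m ≡ false))
  fire-measure v {L = x ∷ L} eq m with armed x in am | Vec.lookup (barred x) v in v∉F | m
  fire-measure v {L = x ∷ L} refl m | true | false | Vec∃.here px =
    Vec∃.here px , refl , inj₁ (weight-bar v x am v∉F)
  fire-measure v {L = x ∷ L} refl m | true | false | Vec∃.there i =
    Vec∃.there (freshen i) , cong (base *_) (capacity-freshen i) ,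
    inj₁ (digit-drops (weight-bar v x am v∉F) (≤-reflexive (capacity-freshen i))
            (measure<capacity (freshen i)))
  fire-measure v {L = x ∷ L} eq m | false | _ | i with fire v L in eq′
  fire-measure v {L = x ∷ L} refl m | false | _ | Vec∃.here px | just L′ =
    Vec∃.here px , refl , inj₂ (refl , am)
  fire-measure v {L = x ∷ L} refl m | false | _ | Vec∃.there i | just L′
    with fire-measure v eq′ i
  ... | i′ , c≡ , inj₁ μ<       =
    Vec∃.there i′ , cong (base *_) c≡ ,
    inj₁ (+-mono-≤-< (≤-reflexive (cong (weight x *_) c≡)) μ<)
  ... | i′ , c≡ , inj₂ (μ≡ , f) =
    Vec∃.there i′ , cong (base *_) c≡ , inj₂ (cong₂ _+_ (cong (weight x *_) c≡) μ≡ , f)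

  fire-keeps : ∀ {e} v {k} {L L′ : Vec Watch k} → fire v L ≡ just L′ → e ∈ʷ L → e ∈ʷ L′
  fire-keeps v eq m = proj₁ (fire-measure v eq m)

-- Watch lists as elements of the algebra

-- The elements α e, β e and τ v named by the members of X and by the types, with
-- enough of the intended meaning of alive and meets.
record WatchSetting {c ℓ} (𝔸 : CTLᶠ-Algebra c ℓ) (X : Set) (N : ℕ) : Set (c ⊔ ℓ) where
  open TemporalAlgebra 𝔸
  field
    α β         : X → Carrier
    τ           : Fin N → Carrier
    alive meets : X → Fin N → Bool
    alive-α     : ∀ {e v} → alive e v ≡ true → τ v ≼ α e
    alive-¬EG   : ∀ {e v} → alive e v ≡ true → Null (τ v ∧ EG (α e) (β e))
    meets-β     : ∀ {e v} → meets e v ≡ true → τ v ≼ β e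

module WatchAlgebra {c ℓ} {𝔸 : CTLᶠ-Algebra c ℓ} {X : Set} {N : ℕ} (S : WatchSetting 𝔸 X N) where

  open TemporalAlgebra 𝔸
  open WatchSetting S
  open Watching alive meets public

  -- The join of a set of types.
  types : Subset N → Carrier
  types F = ⋁ (Vec.lookup F) τ (List.allFin N)

  types-⊥ : Null (types Subset.⊥)
  types-⊥ = ⋁-least _ τ (List.allFin N)
    λ v v∈⊥ → ⊥-elim (Subset.∉⊥ (lookup⇒[]= v Subset.⊥ v∈⊥))

  types-upper : ∀ {F v} → Vec.lookup F v ≡ true → τ v ≼ types F
  types-upper {F} {v} = ⋁-upper _ τ (∈-allFin v)

  types-insert : ∀ F v → types (F ∪ ⁅ v ⁆) ≼ types F ∨ τ v
  types-insert F v = ⋁-least _ τ (List.allFin N) λ u u∈F∪v →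
    [ (λ u∈F → ≼-trans (types-upper {F} ([]=⇒lookup u∈F)) inl)
    , (λ u∈v → subst (λ w → τ w ≼ types F ∨ τ v) (sym (Subset.x∈⁅y⁆⇒x≡y v u∈v)) inr)
    ]′ (Subset.x∈p∪q⁻ F ⁅ v ⁆ (lookup⇒[]= u (F ∪ ⁅ v ⁆) u∈F∪v))

  -- What a watch forbids, and what it promises, relative to the conjunction p of
  -- the promises of higher priority.
  forbidden promise : Watch → Carrier → Carrier
  forbidden (watch e F true)  p = types F ∧ p
  forbidden (watch e F false) p = β e ∧ EU (types F ∧ p) (α e)
  promise x p = ¬ᴬ EU (forbidden x p) (α (watched x))

  -- The conjunction of p with the promises of a list.
  promises : Carrier → ∀ {k} → Vec Watch k → Carrier
  promises p []      = p
  promises p (x ∷ L) = promises (p ∧ promise x p) L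

  promises-≼ : ∀ {p k} (L : Vec Watch k) → promises p L ≼ p
  promises-≼ []      = ≼-refl
  promises-≼ (x ∷ L) = ≼-trans (promises-≼ L) fst

  promise-fresh : ∀ {x p y} → x ≡ fresh x → y ≼ promise x p
  promise-fresh refl =
    ¬-intro (≼-trans snd (EU-null (≼-trans snd (EU-null (≼-trans fst types-⊥)))))

  promises-fresh : ∀ {p k} {L : Vec Watch k} → Vec∀.All (λ x → x ≡ fresh x) L → p ≼ promises p L
  promises-fresh Vec∀.[]       = ≼-refl
  promises-fresh (f Vec∀.∷ fs) = ≼-trans (∧-glb ≼-refl (promise-fresh f)) (promises-fresh fs)

  ¬EU-persists : ∀ {x y} → y ∧ (¬ᴬ EU x y) ≼ □ (¬ᴬ EU x y)
  ¬EU-persists = ¬-intro (contradiction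
    (≼-trans (∧-mono fst (◇-mono ¬¬-elim)) EU-next) (≼-trans fst snd))

  promise-persists : ∀ {x p v} → Settled v x → τ v ∧ promise x p ≼ □ (promise x p)
  promise-persists (inj₁ al) = ≼-trans (∧-mono (alive-α al) ≼-refl) ¬EU-persists
  promise-persists {x} {p} (inj₂ f) = ≼-trans □-⊤ (□-mono (promise-fresh {x} f))

  ∧-promise-persists : ∀ {x p v} → τ v ∧ p ≼ □ p → Settled v x →
                       τ v ∧ (p ∧ promise x p) ≼ □ (p ∧ promise x p)
  ∧-promise-persists {x} h s =
    □-glb (≼-trans (∧-mono ≼-refl fst) h)
          (≼-trans (∧-mono ≼-refl snd) (promise-persists {x} s))

  promises-persist : ∀ {p v k} {L : Vec Watch k} → τ v ∧ p ≼ □ p → Vec∀.All (Settled v) L →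
                     τ v ∧ promises p L ≼ □ (promises p L)
  promises-persist h Vec∀.[] = h
  promises-persist {L = x ∷ L} h (s Vec∀.∷ ss) =
    promises-persist (∧-promise-persists {x} h s) ss

  promise-arm : ∀ {x p v} → alive (watched x) v ≡ true →
                armed x || not (meets (watched x) v) ≡ false →
                τ v ∧ promise x p ≼ promise (arm x) p
  promise-arm {watch e F false} {p} {v} al am = ¬-intro (contradiction
    (≼-trans (∧-glb (≼-trans (≼-trans fst fst) (meets-β (met (meets e v) am))) snd) EU-here)
    (≼-trans fst snd))
    where
    met : ∀ g → not g ≡ false → g ≡ true
    met true _ = refl

  promises-update : ∀ {p v k} (L : Vec Watch k) → τ v ∧ promises p L ≼ promises p (update v L)
  promises-update [] = snd
  promises-update {p} {v} (x ∷ L)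
    with alive (watched x) v in al | armed x || not (meets (watched x) v) in am
  ... | false | _     = ≼-trans snd (≼-trans (≼-trans (promises-≼ L) fst)
                          (promises-fresh (∷ʳ-fresh x (map-fresh-fresh L))))
  ... | true  | true  = promises-update L
  ... | true  | false = ≼-trans
    (∧-glb (≼-trans snd (≼-trans (promises-≼ L) fst))
           (≼-trans (∧-mono ≼-refl (≼-trans (promises-≼ L) snd)) (promise-arm {x} al am)))
    (promises-fresh (map-fresh-fresh L))

  -- A state is a type with a watch list, and its element says that the type
  -- holds now and the promises hold at all successors.
  State : ℕ → Set
  State k = Fin N × Vec Watch k

  ⟪_⟫ : ∀ {k} → State k → Carrier
  ⟪ v , L ⟫ = τ v ∧ □ (promises ⊤ᴬ L)

  private
    ⊤-persists : ∀ {v} → τ v ∧ ⊤ᴬ ≼ □ ⊤ᴬ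
    ⊤-persists = □-⊤

  -- The promises of the updated list hold at v and stay in force after it.
  update-covers : ∀ {v k} (L : Vec Watch k) → τ v ∧ promises ⊤ᴬ L ≼ ⟪ v , update v L ⟫
  update-covers {v} L = ∧-glb fst (≼-trans (∧-glb fst (promises-update L))
    (promises-persist ⊤-persists (update-settled v L)))

  -- Firing an armed watch for e = EG α β: let u be the meet of τ v and the
  -- promises up to this watch.  If u is not null, no-return yields a non-null part
  -- of u after which no α-path meets β and then u.  As the watch is armed, no
  -- α-path reaches a type barred before, so this part satisfies the promise with v
  -- barred as well.
  bar-null : ∀ {e F p v} → alive e v ≡ true → τ v ∧ p ≼ □ p →
             Null (τ v ∧ □ (p ∧ promise (bar v (watch e F true)) p)) →
             Null (τ v ∧ (p ∧ promise (watch e F true) p))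
  bar-null {e} {F} {p} {v} al p-persists null =
    no-return u≼α (≼-trans (∧-mono fst ≼-refl) (alive-¬EG al)) returns
    where
    q Y u : Carrier
    q = promise (watch e F true) p
    Y = forbidden (bar v (watch e F true)) p
    u = τ v ∧ (p ∧ q)

    u≼α : u ≼ α e
    u≼α = ≼-trans fst (alive-α al)

    p∧q-persists : u ≼ □ (p ∧ q)
    p∧q-persists = ∧-promise-persists {watch e F true} p-persists (inj₁ al)

    barred⇒u : (types (F ∪ ⁅ v ⁆) ∧ p) ∧ q ≼ u
    barred⇒u = by-cases (≼-trans fst (≼-trans fst (types-insert F v)))
      (contradiction
        (≼-trans (∧-glb snd (≼-trans fst (≼-trans fst snd))) EU-here) (≼-trans fst snd))
      (∧-glb snd (≼-trans fst (∧-mono snd ≼-refl)))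

    q-persists : q ∧ α e ≼ □ q
    q-persists = ≼-trans (∧-glb snd fst) ¬EU-persists

    narrow : (p ∧ q) ∧ (¬ᴬ (p ∧ (¬ᴬ EU Y (α e)))) ≼ EU (β e ∧ EU u (α e)) (α e)
    narrow = ≼-trans
      (∧-glb (≼-trans fst snd)
             (by-contradiction (contradiction
               (∧-glb (≼-trans fst (≼-trans fst fst)) snd) (≼-trans fst snd))))
      (≼-trans (EU-persistent q-persists)
        (EU-mono (∧-glb (≼-trans fst fst)
          (≼-trans (∧-glb snd (≼-trans fst snd))
            (≼-trans (EU-persistent q-persists) (EU-mono barred⇒u))))))

    returns : u ≼ ◇ (EU (β e ∧ EU u (α e)) (α e))
    returns = ≼-trans (∧-glb p∧q-persists (by-contradiction (≼-trans (∧-mono fst ≼-refl) null)))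
      (≼-trans □-◇ (◇-mono narrow))

  -- If firing fails or leads to a null state, the promises are inconsistent with v.
  fire-null : ∀ {p v k} (L : Vec Watch k) → τ v ∧ p ≼ □ p → Vec∀.All (Settled v) L →
              (∀ {L′} → fire v L ≡ just L′ → Null (τ v ∧ □ (promises p L′))) →
              Null (τ v ∧ promises p L)
  fire-null [] h settled null = ≼-trans (∧-glb fst h) (null refl)
  fire-null {p} {v} (x ∷ L) h (s Vec∀.∷ ss) null
    with armed x in am | Vec.lookup (barred x) v in v∈F
  fire-null {p} {v} (watch e F true ∷ L) h (s Vec∀.∷ ss) null | true | true =
    contradiction
      (≼-trans (∧-mono (types-upper {F} v∈F) (≼-trans (promises-≼ L) fst)) EU-here)
      (≼-trans snd (≼-trans (promises-≼ L) snd))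
  fire-null {p} {v} (watch e F true ∷ L) h (inj₁ al Vec∀.∷ ss) null | true | false =
    ≼-trans (∧-mono ≼-refl (promises-≼ L)) (bar-null {e} {F} al h
      (≼-trans (∧-mono ≼-refl (□-mono (promises-fresh (map-fresh-fresh L)))) (null refl)))
  fire-null {p} {v} (x ∷ L) h (s Vec∀.∷ ss) null | false | _ =
    fire-null L (∧-promise-persists {x} h s) ss λ eq → null (cong (Maybe.map (x ∷_)) eq)

  -- If every way to pass to v and fire gives a null state, then v is not possible
  -- under the promises of L.
  strict-null : ∀ {v k} (L : Vec Watch k) →
    (∀ {L′} → fire v (update v L) ≡ just L′ → Null ⟪ v , L′ ⟫) → Null (τ v ∧ promises ⊤ᴬ L)
  strict-null {v} L null = ≼-trans (∧-glb fst (promises-update L))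
    (fire-null (update v L) ⊤-persists (update-settled v L) null)

-- Types

-- A type decides every member of a finite list of elements.
module Atoms {c ℓ} (𝔸 : CTLᶠ-Algebra c ℓ) {A : Set} (f : A → CTLᶠ-Algebra.Carrier 𝔸) where

  open TemporalAlgebra 𝔸

  -- The decision of a type on an occurrence in the list.  Different occurrences of
  -- the same element are decided independently.
  value : ∀ {x : A} {xs : List A} → x ∈ xs → Vec Bool (List.length xs) → Bool
  value (here _)  (b ∷ _)  = b
  value (there i) (_ ∷ bs) = value i bs

  -- The meet of the literals of a type.
  atom : ∀ (xs : List A) → Vec Bool (List.length xs) → Carrier
  atom []       []       = ⊤ᴬ
  atom (x ∷ xs) (b ∷ bs) = (if b then f x else (¬ᴬ f x)) ∧ atom xs bs

  atom-true : ∀ {x} {xs : List A} (i : x ∈ xs) bs → value i bs ≡ true → atom xs bs ≼ f x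
  atom-true (here refl) (true ∷ bs) refl = fst
  atom-true (there i)   (b ∷ bs)    eq   = ≼-trans snd (atom-true i bs eq)

  atom-false : ∀ {x} {xs : List A} (i : x ∈ xs) bs → value i bs ≡ false → atom xs bs ≼ ¬ᴬ f x
  atom-false (here refl) (false ∷ bs) refl = fst
  atom-false (there i)   (b ∷ bs)     eq   = ≼-trans snd (atom-false i bs eq)

  -- The atoms cover the algebra: an ideal that contains the part of y below each
  -- atom contains y.
  atoms-cover : ∀ {ι} (I : Carrier → Set ι) →
                (∀ {x y} → x ≼ y → I y → I x) → (∀ {x y} → I x → I y → I (x ∨ y)) →
                ∀ (xs : List A) {y} → (∀ bs → I (atom xs bs ∧ y)) → I y
  atoms-cover I down join []       h = down (∧-glb ⊤-greatest ≼-refl) (h [])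
  atoms-cover I down join (x ∷ xs) h = atoms-cover I down join xs λ bs →
    down (by-cases excluded-middle
           (≼-trans (∧-glb (∧-glb snd (≼-trans fst fst)) (≼-trans fst snd)) inl)
           (≼-trans (∧-glb (∧-glb snd (≼-trans fst fst)) (≼-trans fst snd)) inr))
         (join (h (true ∷ bs)) (h (false ∷ bs)))

-- The closure of a formula

-- Immediate subformulas.
data _◁_ {n} : Formula n → Formula n → Set where
  ¬◁  : ∀ {φ}   → φ ◁ (¬ᶠ φ)
  ◇◁  : ∀ {φ}   → φ ◁ (◇ᶠ φ)
  ∨◁ˡ : ∀ {φ ψ} → φ ◁ (φ ∨ᶠ ψ)
  ∨◁ʳ : ∀ {φ ψ} → ψ ◁ (φ ∨ᶠ ψ)
  EU◁ˡ : ∀ {φ ψ} → φ ◁ EUᶠ φ ψ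
  EU◁ʳ : ∀ {φ ψ} → ψ ◁ EUᶠ φ ψ
  EG◁ˡ : ∀ {φ ψ} → φ ◁ EGᶠ φ ψ
  EG◁ʳ : ∀ {φ ψ} → ψ ◁ EGᶠ φ ψ

module _ {n : ℕ} where

  subformulas proper : Formula n → List (Formula n)
  subformulas φ = φ ∷ proper φ
  proper (var p)   = []
  proper ⊥ᶠ        = []
  proper (¬ᶠ φ)    = subformulas φ
  proper (◇ᶠ φ)    = subformulas φ
  proper (φ ∨ᶠ ψ)  = subformulas φ ++ subformulas ψ
  proper (EUᶠ φ ψ) = subformulas φ ++ subformulas ψ
  proper (EGᶠ φ ψ) = subformulas φ ++ subformulas ψ

  immediate : ∀ {ψ χ : Formula n} → ψ ◁ χ → ψ ∈ proper χ
  immediate ¬◁           = here refl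
  immediate ◇◁           = here refl
  immediate ∨◁ˡ          = here refl
  immediate (∨◁ʳ {φ})    = ∈-++⁺ʳ (subformulas φ) (here refl)
  immediate EU◁ˡ         = here refl
  immediate (EU◁ʳ {φ})   = ∈-++⁺ʳ (subformulas φ) (here refl)
  immediate EG◁ˡ         = here refl
  immediate (EG◁ʳ {φ})   = ∈-++⁺ʳ (subformulas φ) (here refl)

  subformulas-closed : ∀ φ {ψ χ : Formula n} → χ ∈ subformulas φ → ψ ◁ χ → ψ ∈ subformulas φ
  proper-closed      : ∀ φ {ψ χ : Formula n} → χ ∈ proper φ → ψ ◁ χ → ψ ∈ proper φ
  binary-closed      : ∀ φ₁ φ₂ {ψ χ : Formula n} → χ ∈ subformulas φ₁ ++ subformulas φ₂ → ψ ◁ χ →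
                       ψ ∈ subformulas φ₁ ++ subformulas φ₂

  subformulas-closed φ (here refl) d = there (immediate d)
  subformulas-closed φ (there i)   d = there (proper-closed φ i d)

  proper-closed (¬ᶠ φ)    = subformulas-closed φ
  proper-closed (◇ᶠ φ)    = subformulas-closed φ
  proper-closed (φ ∨ᶠ ψ)  = binary-closed φ ψ
  proper-closed (EUᶠ φ ψ) = binary-closed φ ψ
  proper-closed (EGᶠ φ ψ) = binary-closed φ ψ

  binary-closed φ₁ φ₂ i d with ∈-++⁻ (subformulas φ₁) i
  ... | inj₁ j = ∈-++⁺ˡ (subformulas-closed φ₁ j d)
  ... | inj₂ j = ∈-++⁺ʳ (subformulas φ₁) (subformulas-closed φ₂ j d)

  -- All variables are included, so that a type determines a set of variables.
  closure : Formula n → List (Formula n)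
  closure φ = subformulas φ ++ List.map var (List.allFin n)

  abstract

    ∈-closure : ∀ φ → φ ∈ closure φ
    ∈-closure φ = here refl

    variable-∈-closure : ∀ φ p → var p ∈ closure φ
    variable-∈-closure φ p = ∈-++⁺ʳ (subformulas φ) (∈-map⁺ var (∈-allFin p))

    closure-closed : ∀ φ {ψ χ : Formula n} → χ ∈ closure φ → ψ ◁ χ → ψ ∈ closure φ
    closure-closed φ i d with ∈-++⁻ (subformulas φ) i
    ... | inj₁ j = ∈-++⁺ˡ (subformulas-closed φ j d)
    ... | inj₂ j with ∈-map⁻ var j
    closure-closed φ i () | inj₂ j | _ , _ , refl

  -- The occurrences of EG-formulas in a list.
  Fair : List (Formula n) → Set
  Fair Γ = ∃[ φ ] ∃[ ψ ] EGᶠ φ ψ ∈ Γ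

  private
    fairHead : ∀ (χ : Formula n) → List (∃[ φ ] ∃[ ψ ] EGᶠ φ ψ ≡ χ)
    fairHead (EGᶠ φ ψ) = [ φ , ψ , refl ]
    fairHead _         = []

    first : ∀ {χ : Formula n} {Γ} → (∃[ φ ] ∃[ ψ ] EGᶠ φ ψ ≡ χ) → Fair (χ ∷ Γ)
    first (φ , ψ , eq) = φ , ψ , here eq

    later : ∀ {χ : Formula n} {Γ} → Fair Γ → Fair (χ ∷ Γ)
    later (φ , ψ , i) = φ , ψ , there i

  listedFair : ∀ (Γ : List (Formula n)) → Listed (Fair Γ)
  listedFair Γ = record { elements = fairs Γ ; complete = λ (φ , ψ , i) → fairs-complete i }
    where
    fairs : ∀ (Γ : List (Formula n)) → List (Fair Γ)
    fairs []      = []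
    fairs (χ ∷ Γ) = List.map first (fairHead χ) ++ List.map later (fairs Γ)

    fairs-complete : ∀ {φ ψ} {Γ : List (Formula n)} (i : EGᶠ φ ψ ∈ Γ) → (φ , ψ , i) ∈ fairs Γ
    fairs-complete (here refl)           = here refl
    fairs-complete {Γ = χ ∷ _} (there i) =
      ∈-++⁺ʳ (List.map first (fairHead χ)) (∈-map⁺ later (fairs-complete i))

-- Elimination of states

private
  imply : ∀ a b → (a ≡ true × b ≡ false) ⊎ (a ≡ true → b ≡ true)
  imply true  true  = inj₂ λ _ → refl
  imply true  false = inj₁ (refl , refl)
  imply false _     = inj₂ λ ()

  &&-true : ∀ {a b} → a && b ≡ true → a ≡ true × b ≡ true
  &&-true {true} {true} _ = refl , refl

  not-true : ∀ {a} → not a ≡ true → a ≡ false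
  not-true {false} _ = refl

module Elimination {c ℓ} (𝔸 : CTLᶠ-Algebra c ℓ)
  {n : ℕ} (V : Fin n → CTLᶠ-Algebra.Carrier 𝔸) (Γ : List (Formula n))
  (closed : ∀ {ψ χ} → χ ∈ Γ → ψ ◁ χ → ψ ∈ Γ)
  (variable-∈ : ∀ p → var p ∈ Γ)
  where

  open TemporalAlgebra 𝔸
  open Interpretation 𝔸 V using (⟦_⟧)
  open Atoms 𝔸 ⟦_⟧

  -- Only the completeness of these enumerations matters.
  abstract

    valuations : Listed (Vec Bool (List.length Γ))
    valuations = listedVec listedBool (List.length Γ)

    fairs : Listed (Fair Γ)
    fairs = listedFair Γ

  -- Types are numbered, so that sets of types can be given as elements of Subset N.
  N : ℕ
  N = List.length (elements valuations)

  bits : Fin N → Vec Bool (List.length Γ)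
  bits = List.lookup (elements valuations)

  -- Membership of an occurrence of a formula of Γ in a type.
  val : ∀ {ψ} → ψ ∈ Γ → Fin N → Bool
  val i v = value i (bits v)

  infix 4 _∋_
  _∋_ : ∀ {ψ} → Fin N → ψ ∈ Γ → Set
  v ∋ i = val i v ≡ true

  τ : Fin N → Carrier
  τ v = atom Γ (bits v)

  τ-true : ∀ {ψ v} (i : ψ ∈ Γ) → v ∋ i → τ v ≼ ⟦ ψ ⟧
  τ-true i = atom-true i _

  τ-false : ∀ {ψ v} (i : ψ ∈ Γ) → val i v ≡ false → τ v ≼ ¬ᴬ ⟦ ψ ⟧
  τ-false i = atom-false i _

  types-cover : ∀ {ι} (I : Carrier → Set ι) →
                (∀ {x y} → x ≼ y → I y → I x) → (∀ {x y} → I x → I y → I (x ∨ y)) →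
                ∀ {y} → (∀ v → I (τ v ∧ y)) → I y
  types-cover I down join {y} h = atoms-cover I down join Γ λ bs →
    subst (λ bs → I (atom Γ bs ∧ y)) (sym (lookup-index (complete valuations bs)))
      (h (Any.index (complete valuations bs)))

  null-or-∋ : ∀ {ψ} (i : ψ ∈ Γ) v → Null (τ v ∧ ⟦ ψ ⟧) ⊎ v ∋ i
  null-or-∋ i v with val i v in eq
  ... | true  = inj₂ refl
  ... | false = inj₁ (contradiction snd (≼-trans fst (τ-false i eq)))

  -- See Watching for the meaning of these.
  alive meets : Fair Γ → Fin N → Bool
  alive (φ , ψ , i) v = val (closed i EG◁ˡ) v && not (val i v)
  meets (φ , ψ , i) v = val (closed i EG◁ʳ) v

  setting : WatchSetting 𝔸 (Fair Γ) N
  setting = record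
    { α         = λ (φ , _) → ⟦ φ ⟧
    ; β         = λ (_ , ψ , _) → ⟦ ψ ⟧
    ; τ         = τ
    ; alive     = alive
    ; meets     = meets
    ; alive-α   = λ {(φ , ψ , i)} {v} al →
        τ-true (closed i EG◁ˡ) (proj₁ (&&-true {val (closed i EG◁ˡ) v} al))
    ; alive-¬EG = λ {(φ , ψ , i)} {v} al →
        ¬-elim (τ-false i (not-true (proj₂ (&&-true {val (closed i EG◁ˡ) v} al))))
    ; meets-β   = λ {(φ , ψ , i)} → τ-true (closed i EG◁ʳ)
    }

  open WatchAlgebra setting renaming (State to StateOfLength)

  K : ℕ
  K = List.length (elements fairs)

  State : Set
  State = StateOfLength K

  abstract

    listedState : Listed State
    listedState = listed× (listedFin N) (listedVec listedWatch K)
      where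
      listedWatch : Listed Watch
      listedWatch = listedImage (λ (e , F , f) → watch e F f) (λ (watch e F f) → e , F , f)
        (λ _ → refl) (listed× fairs (listed× (listedVec listedBool N) listedBool))

  -- Conditions on a single type.
  LocalAt : Fin N → ∀ ψ → ψ ∈ Γ → Set
  LocalAt v (var p)    i = val i v ≡ val (variable-∈ p) v
  LocalAt v ⊥ᶠ         i = val i v ≡ false
  LocalAt v (¬ᶠ φ)     i = val i v ≡ not (val (closed i ¬◁) v)
  LocalAt v (◇ᶠ φ)     i = ⊤
  LocalAt v (φ ∨ᶠ ψ)   i = val i v ≡ val (closed i ∨◁ˡ) v || val (closed i ∨◁ʳ) v
  LocalAt v (EUᶠ φ ψ)  i = (v ∋ closed i EU◁ˡ → v ∋ i) ×
                           (v ∋ i → v ∋ closed i EU◁ˡ ⊎ v ∋ closed i EU◁ʳ)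
  LocalAt v (EGᶠ φ ψ)  i = v ∋ i → v ∋ closed i EG◁ˡ

  -- Conditions on the types of a node and of one of its successors.
  CoherentAt : Fin N → Fin N → ∀ ψ → ψ ∈ Γ → Set
  CoherentAt u v (◇ᶠ φ)    i = v ∋ closed i ◇◁ → u ∋ i
  CoherentAt u v (EUᶠ φ ψ) i = u ∋ closed i EU◁ʳ → v ∋ i → u ∋ i
  CoherentAt u v (EGᶠ φ ψ) i = u ∋ closed i EG◁ˡ → v ∋ i → u ∋ i
  CoherentAt u v _         i = ⊤

  Coherent : Fin N → Fin N → Set
  Coherent u v = ∀ ψ (i : ψ ∈ Γ) → CoherentAt u v ψ i

  null-or-local : ∀ v ψ (i : ψ ∈ Γ) → Null (τ v) ⊎ LocalAt v ψ i
  null-or-local v (var p) i with val i v in eq | val (variable-∈ p) v in eq′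
  ... | true  | true  = inj₂ refl
  ... | true  | false = inj₁ (contradiction (τ-true i eq) (τ-false (variable-∈ p) eq′))
  ... | false | true  = inj₁ (contradiction (τ-true (variable-∈ p) eq′) (τ-false i eq))
  ... | false | false = inj₂ refl
  null-or-local v ⊥ᶠ i with val i v in eq
  ... | true  = inj₁ (τ-true i eq)
  ... | false = inj₂ refl
  null-or-local v (¬ᶠ φ) i with val i v in eq | val (closed i ¬◁) v in eq′
  ... | true  | true  = inj₁ (contradiction (τ-true (closed i ¬◁) eq′) (τ-true i eq))
  ... | true  | false = inj₂ refl
  ... | false | true  = inj₂ refl
  ... | false | false = inj₁ (contradiction (τ-false (closed i ¬◁) eq′) (τ-false i eq))
  null-or-local v (◇ᶠ φ) i = inj₂ tt
  null-or-local v (φ ∨ᶠ ψ) i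
    with val i v in eq | val (closed i ∨◁ˡ) v in eq₁ | val (closed i ∨◁ʳ) v in eq₂
  ... | true  | true  | _     = inj₂ refl
  ... | true  | false | true  = inj₂ refl
  ... | true  | false | false = inj₁ (by-cases (τ-true i eq)
          (contradiction snd (≼-trans fst (τ-false (closed i ∨◁ˡ) eq₁)))
          (contradiction snd (≼-trans fst (τ-false (closed i ∨◁ʳ) eq₂))))
  ... | false | true  | _     =
          inj₁ (contradiction (≼-trans (τ-true (closed i ∨◁ˡ) eq₁) inl) (τ-false i eq))
  ... | false | false | true  =
          inj₁ (contradiction (≼-trans (τ-true (closed i ∨◁ʳ) eq₂) inr) (τ-false i eq))
  ... | false | false | false = inj₂ refl
  null-or-local v (EUᶠ φ ψ) i
    with val i v in eq | val (closed i EU◁ˡ) v in eq₁ | val (closed i EU◁ʳ) v in eq₂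
  ... | true  | true  | _     = inj₂ ((λ _ → refl) , λ _ → inj₁ refl)
  ... | true  | false | true  = inj₂ ((λ _ → refl) , λ _ → inj₂ refl)
  ... | true  | false | false = inj₁ (by-cases (≼-trans (τ-true i eq) EU-unfold)
          (contradiction snd (≼-trans fst (τ-false (closed i EU◁ˡ) eq₁)))
          (contradiction (≼-trans snd fst) (≼-trans fst (τ-false (closed i EU◁ʳ) eq₂))))
  ... | false | true  | _     =
          inj₁ (contradiction (≼-trans (τ-true (closed i EU◁ˡ) eq₁) EU-here) (τ-false i eq))
  ... | false | false | _     = inj₂ ((λ ()) , (λ ()))
  null-or-local v (EGᶠ φ ψ) i with imply (val i v) (val (closed i EG◁ˡ) v)
  ... | inj₁ (eq , eq′) =
          inj₁ (contradiction (≼-trans (τ-true i eq) EG-holds) (τ-false (closed i EG◁ˡ) eq′))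
  ... | inj₂ h          = inj₂ h

  null-or-coherentAt : ∀ u v ψ (i : ψ ∈ Γ) → Null (τ u ∧ ◇ (τ v)) ⊎ CoherentAt u v ψ i
  null-or-coherentAt u v (var p)   i = inj₂ tt
  null-or-coherentAt u v ⊥ᶠ        i = inj₂ tt
  null-or-coherentAt u v (¬ᶠ φ)    i = inj₂ tt
  null-or-coherentAt u v (φ ∨ᶠ ψ)  i = inj₂ tt
  null-or-coherentAt u v (◇ᶠ φ)    i with imply (val (closed i ◇◁) v) (val i u)
  ... | inj₂ h          = inj₂ h
  ... | inj₁ (eq , eq′) = inj₁ (contradiction
          (≼-trans snd (◇-mono (τ-true (closed i ◇◁) eq))) (≼-trans fst (τ-false i eq′)))
  null-or-coherentAt u v (EUᶠ φ ψ) i with val (closed i EU◁ʳ) u in eq | imply (val i v) (val i u)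
  ... | false | _                 = inj₂ λ ()
  ... | true  | inj₂ h            = inj₂ λ _ → h
  ... | true  | inj₁ (eq₁ , eq₂)  = inj₁ (contradiction
          (≼-trans (∧-mono (τ-true (closed i EU◁ʳ) eq) (◇-mono (τ-true i eq₁))) EU-next)
          (≼-trans fst (τ-false i eq₂)))
  null-or-coherentAt u v (EGᶠ φ ψ) i with val (closed i EG◁ˡ) u in eq | imply (val i v) (val i u)
  ... | false | _                 = inj₂ λ ()
  ... | true  | inj₂ h            = inj₂ λ _ → h
  ... | true  | inj₁ (eq₁ , eq₂)  = inj₁ (contradiction
          (≼-trans (∧-mono (τ-true (closed i EG◁ˡ) eq) (◇-mono (τ-true i eq₁))) EG-prepend)
          (≼-trans fst (τ-false i eq₂)))

  null-or-coherent : ∀ u v → Null (τ u ∧ ◇ (τ v)) ⊎ Coherent u v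
  null-or-coherent u v = alternative⊎all Γ (CoherentAt u v) (null-or-coherentAt u v)

  -- Every successor has some type and keeps the promises.
  next-null : ∀ {u} (L : Vec Watch K) {x} →
              (∀ v → Null (τ u ∧ ◇ (τ v ∧ (promises ⊤ᴬ L ∧ x)))) → Null (⟪ u , L ⟫ ∧ ◇ x)
  next-null {u} L {x} h =
    ≼-trans (∧-glb (≼-trans fst fst) (≼-trans (∧-mono snd ≼-refl) □-◇))
      (types-cover (λ z → Null (τ u ∧ ◇ z))
        (λ z≼z′ → ≼-trans (∧-mono ≼-refl (◇-mono z≼z′)))
        (λ p q → by-cases (≼-trans snd ◇-∨-split)
                   (≼-trans (∧-mono fst ≼-refl) p) (≼-trans (∧-mono fst ≼-refl) q))
        h)

  -- Let E be a set of states that have been eliminated.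
  module _ (E : State → Bool) where

    -- A strict step fires the first armed watch, if there is one, and so makes
    -- progress towards refuting an EG-formula.
    record Strict (s t : State) : Set where
      field
        coherent : Coherent (proj₁ s) (proj₁ t)
        fires    : fire (proj₁ t) (update (proj₁ t) (proj₂ s)) ≡ just (proj₂ t)
        survives : E t ≡ false

    -- A lazy step fires nothing.
    record Lazy (s t : State) : Set where
      field
        coherent : Coherent (proj₁ s) (proj₁ t)
        updates  : update (proj₁ t) (proj₂ s) ≡ proj₂ t
        survives : E t ≡ false

    -- A finite lazy path to a state whose type satisfies P, through types
    -- satisfying Q.
    data Reaches (P Q : Fin N → Set) : State → Set where
      stop : ∀ {s} → P (proj₁ s) → Reaches P Q s
      step : ∀ {s t} → Q (proj₁ s) → Lazy s t → Reaches P Q t → Reaches P Q s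

    -- The successors and the finite paths that a state must have on account of a
    -- formula of its type.
    SuccessorAt PathAt GoodAt : State → ∀ ψ → ψ ∈ Γ → Set

    SuccessorAt s (◇ᶠ φ)    i =
      proj₁ s ∋ i → ∃[ t ] Strict s t × proj₁ t ∋ closed i ◇◁
    SuccessorAt s (EUᶠ φ ψ) i =
      proj₁ s ∋ i → proj₁ s ∋ closed i EU◁ˡ ⊎ ∃[ t ] Strict s t × proj₁ t ∋ i
    SuccessorAt s (EGᶠ φ ψ) i =
      proj₁ s ∋ i → ∃[ t ] Strict s t × proj₁ t ∋ i
    SuccessorAt s _         i = ⊤

    PathAt s (EUᶠ φ ψ) i =
      proj₁ s ∋ i → Reaches (_∋ closed i EU◁ˡ) (_∋ closed i EU◁ʳ) s
    PathAt s (EGᶠ φ ψ) i =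
      proj₁ s ∋ i → Reaches (λ v → v ∋ closed i EG◁ʳ × v ∋ i) (_∋ closed i EG◁ˡ) s
    PathAt s _         i = ⊤

    GoodAt s ψ i = LocalAt (proj₁ s) ψ i × SuccessorAt s ψ i × PathAt s ψ i

    record Good (s : State) : Set where
      field
        successor : ∃[ t ] Strict s t
        good      : ∀ ψ (i : ψ ∈ Γ) → GoodAt s ψ i

    module _ (sound : ∀ s → E s ≡ true → Null ⟪ s ⟫) where

      -- If ◇ x is consistent with s, then s has a strict successor whose type is
      -- consistent with x.  Here and below, P v stands for this consistency.
      null-or-strict : ∀ {x} {P : Fin N → Set} → (∀ v → Null (τ v ∧ x) ⊎ P v) →
                       ∀ s → Null (⟪ s ⟫ ∧ ◇ x) ⊎ ∃[ t ] Strict s t × P (proj₁ t)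
      null-or-strict {x} {P} dich s@(u , L)
        with all⊎any (listedFin N) candidate
        where
        candidate : ∀ v → Null (τ u ∧ ◇ (τ v ∧ (promises ⊤ᴬ L ∧ x))) ⊎
                          ∃[ L′ ] Strict s (v , L′) × P v
        candidate v with null-or-coherent u v | dich v | fire v (update v L) in eq
        ... | inj₁ null | _         | _       = inj₁ (≼-trans (∧-mono ≼-refl (◇-mono fst)) null)
        ... | inj₂ _    | inj₁ null | _       =
              inj₁ (≼-trans snd (◇-null (≼-trans (∧-mono ≼-refl snd) null)))
        ... | inj₂ _    | inj₂ _    | nothing = inj₁ (≼-trans snd (◇-null
              (≼-trans (∧-mono ≼-refl fst)
                (strict-null L λ eq′ → nothing≢just (trans (sym eq) eq′)))))
          where
          nothing≢just : ∀ {L′ : Vec Watch K} {z} → nothing ≡ just L′ → z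
          nothing≢just ()
        ... | inj₂ coh  | inj₂ p    | just L′ with E (v , L′) in eqE
        ...   | false = inj₂ (L′ , record { coherent = coh ; fires = eq ; survives = eqE } , p)
        ...   | true  = inj₁ (≼-trans snd (◇-null (≼-trans (∧-mono ≼-refl fst)
              (strict-null L λ eq′ → eliminated (trans (sym eq) eq′)))))
          where
          eliminated : ∀ {L″} → just L′ ≡ just L″ → Null ⟪ v , L″ ⟫
          eliminated refl = sound _ eqE
      ... | inj₁ null         = inj₁ (next-null L null)
      ... | inj₂ (v , L′ , h) = inj₂ ((v , L′) , h)

      -- A state consistent with EU x y reaches x along y by lazy steps, because
      -- the complement of the join of the states that do not is a pre-fixpoint.
      null-or-reaches : ∀ {x y} {P Q : Fin N → Set} →
                        (∀ v → Null (τ v ∧ x) ⊎ P v) → (∀ v → Null (τ v ∧ y) ⊎ Q v) →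
                        ∀ s → Null (⟪ s ⟫ ∧ EU x y) ⊎ Reaches P Q s
      null-or-reaches {x} {y} {P} {Q} dichP dichQ s
        with saturate listedState (Reaches P Q) Blocked block
        where
        Blocked : (State → Bool) → State → Set ℓ
        Blocked S (u , L) = Null (τ u ∧ x) × (Null (τ u ∧ y) ⊎
          (∀ v → Null (τ u ∧ ◇ (τ v)) ⊎ E (v , update v L) ≡ true ⊎ S (v , update v L) ≡ false))

        block : ∀ S → (∀ s → S s ≡ true → Reaches P Q s) → ∀ s → Reaches P Q s ⊎ Blocked S s
        block S reaches s@(u , L) with dichP u | dichQ u
        ... | inj₂ p  | _       = inj₁ (stop p)
        ... | inj₁ ¬p | inj₁ ¬q = inj₂ (¬p , inj₁ ¬q)
        ... | inj₁ ¬p | inj₂ q  with all⊎any (listedFin N) candidate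
          where
          candidate : ∀ v → (Null (τ u ∧ ◇ (τ v)) ⊎ E (v , update v L) ≡ true ⊎
                             S (v , update v L) ≡ false) ⊎ Reaches P Q s
          candidate v
            with null-or-coherent u v | E (v , update v L) in eqE | S (v , update v L) in eqS
          ... | inj₁ null | _     | _     = inj₁ (inj₁ null)
          ... | inj₂ _    | true  | _     = inj₁ (inj₂ (inj₁ refl))
          ... | inj₂ _    | false | false = inj₁ (inj₂ (inj₂ refl))
          ... | inj₂ coh  | false | true  = inj₂ (step q
                record { coherent = coh ; updates = refl ; survives = eqE } (reaches _ eqS))
        ...   | inj₁ h       = inj₂ (¬p , inj₂ h)
        ...   | inj₂ (_ , r) = inj₁ r
      ... | S , reaches , blocked with S s in eqS
      ...   | true  = inj₂ (reaches s eqS)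
      ...   | false = inj₁ (≼-trans
                (∧-mono (⋁-upper _ (⟪_⟫ {K}) (complete listedState s) (cong not eqS)) ≼-refl)
                (contradiction fst (≼-trans snd (EU-least here⁺ next⁺))))
        where
        z : Carrier
        z = ⋁ (not ∘ S) (⟪_⟫ {K}) (elements listedState)

        contrapose : ∀ {w} → z ≼ ¬ᴬ w → w ≼ ¬ᴬ z
        contrapose h = ¬-intro (contradiction fst (≼-trans snd h))

        here⁺ : x ≼ ¬ᴬ z
        here⁺ = contrapose (⋁-least _ (⟪_⟫ {K}) (elements listedState) λ t t∉S →
          ¬-intro (≼-trans (∧-mono fst ≼-refl) (proj₁ (blocked t (not-true t∉S)))))

        stuck : ∀ (t : State) → S t ≡ false → Null (⟪ t ⟫ ∧ (y ∧ ◇ (¬ᴬ z)))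
        stuck t@(u , L) t∉S with proj₂ (blocked t t∉S)
        ... | inj₁ ¬q = ≼-trans (∧-mono fst fst) ¬q
        ... | inj₂ h  = ≼-trans (∧-mono ≼-refl snd) (next-null L excluded)
          where
          excluded : ∀ v → Null (τ u ∧ ◇ (τ v ∧ (promises ⊤ᴬ L ∧ (¬ᴬ z))))
          excluded v with h v
          ... | inj₁ null          = ≼-trans (∧-mono ≼-refl (◇-mono fst)) null
          ... | inj₂ (inj₁ elim)   = ≼-trans snd (◇-null
                (≼-trans (∧-mono ≼-refl fst) (≼-trans (update-covers {v} L) (sound _ elim))))
          ... | inj₂ (inj₂ v∉S)    = ≼-trans snd (◇-null (contradiction
                (≼-trans (∧-mono ≼-refl fst) (≼-trans (update-covers {v} L)
                  (⋁-upper _ (⟪_⟫ {K}) (complete listedState _) (cong not v∉S))))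
                (≼-trans snd snd)))

        next⁺ : y ∧ ◇ (¬ᴬ z) ≼ ¬ᴬ z
        next⁺ = contrapose (⋁-least _ (⟪_⟫ {K}) (elements listedState) λ t t∉S →
          ¬-intro (stuck t (not-true t∉S)))

      -- If a formula of the type of s demands something, s is null or satisfies
      -- the demand.
      demand : ∀ {ψ x} {D : Set} (s : State) (i : ψ ∈ Γ) → ⟦ ψ ⟧ ≼ x → Null (⟪ s ⟫ ∧ x) ⊎ D →
               Null ⟪ s ⟫ ⊎ (proj₁ s ∋ i → D)
      demand s i ψ≼x (inj₂ d) = inj₂ λ _ → d
      demand s i ψ≼x (inj₁ null) with val i (proj₁ s) in eq
      ... | true  = inj₁ (≼-trans (∧-glb ≼-refl (≼-trans fst (≼-trans (τ-true i eq) ψ≼x))) null)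
      ... | false = inj₂ λ ()

      null-or-successorAt : ∀ s ψ (i : ψ ∈ Γ) → Null ⟪ s ⟫ ⊎ SuccessorAt s ψ i
      null-or-successorAt s (var p)   i = inj₂ tt
      null-or-successorAt s ⊥ᶠ        i = inj₂ tt
      null-or-successorAt s (¬ᶠ φ)    i = inj₂ tt
      null-or-successorAt s (φ ∨ᶠ ψ)  i = inj₂ tt
      null-or-successorAt s (◇ᶠ φ)    i =
        demand s i ≼-refl (null-or-strict (null-or-∋ (closed i ◇◁)) s)
      null-or-successorAt s (EUᶠ φ ψ) i =
        demand s i ≼-refl (later (null-or-∋ (closed i EU◁ˡ) (proj₁ s))
                               (null-or-strict (null-or-∋ i) s))
        where
        later : ∀ {A B : Set} → Null (τ (proj₁ s) ∧ ⟦ φ ⟧) ⊎ A →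
                Null (⟪ s ⟫ ∧ ◇ ⟦ EUᶠ φ ψ ⟧) ⊎ B → Null (⟪ s ⟫ ∧ ⟦ EUᶠ φ ψ ⟧) ⊎ (A ⊎ B)
        later (inj₂ a) _        = inj₂ (inj₁ a)
        later (inj₁ _) (inj₂ b) = inj₂ (inj₂ b)
        later (inj₁ p) (inj₁ q) = inj₁ (by-cases (≼-trans snd EU-unfold)
          (≼-trans (∧-mono (≼-trans fst fst) ≼-refl) p) (≼-trans (∧-mono fst snd) q))
      null-or-successorAt s (EGᶠ φ ψ) i =
        demand s i EG-continues (null-or-strict (null-or-∋ i) s)

      null-or-pathAt : ∀ s ψ (i : ψ ∈ Γ) → Null ⟪ s ⟫ ⊎ PathAt s ψ i
      null-or-pathAt s (var p)   i = inj₂ tt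
      null-or-pathAt s ⊥ᶠ        i = inj₂ tt
      null-or-pathAt s (¬ᶠ φ)    i = inj₂ tt
      null-or-pathAt s (φ ∨ᶠ ψ)  i = inj₂ tt
      null-or-pathAt s (◇ᶠ φ)    i = inj₂ tt
      null-or-pathAt s (EUᶠ φ ψ) i =
        demand s i ≼-refl
          (null-or-reaches (null-or-∋ (closed i EU◁ˡ)) (null-or-∋ (closed i EU◁ʳ)) s)
      null-or-pathAt s (EGᶠ φ ψ) i =
        demand s i EG-reaches (null-or-reaches target (null-or-∋ (closed i EG◁ˡ)) s)
        where
        target : ∀ v → Null (τ v ∧ (⟦ ψ ⟧ ∧ ⟦ EGᶠ φ ψ ⟧)) ⊎ (v ∋ closed i EG◁ʳ × v ∋ i)
        target v with null-or-∋ (closed i EG◁ʳ) v | null-or-∋ i v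
        ... | inj₁ p | _      = inj₁ (≼-trans (∧-mono ≼-refl fst) p)
        ... | inj₂ _ | inj₁ q = inj₁ (≼-trans (∧-mono ≼-refl snd) q)
        ... | inj₂ p | inj₂ q = inj₂ (p , q)

      null-or-good : ∀ s → Null ⟪ s ⟫ ⊎ Good s
      null-or-good s
        with null-or-strict {⊤ᴬ} (λ _ → inj₂ tt) s | alternative⊎all Γ (GoodAt s) goodAt
        where
        goodAt : ∀ ψ (i : ψ ∈ Γ) → Null ⟪ s ⟫ ⊎ GoodAt s ψ i
        goodAt ψ i
          with null-or-local (proj₁ s) ψ i | null-or-successorAt s ψ i | null-or-pathAt s ψ i
        ... | inj₁ p | _      | _      = inj₁ (≼-trans fst p)
        ... | inj₂ _ | inj₁ p | _      = inj₁ p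
        ... | inj₂ _ | inj₂ _ | inj₁ p = inj₁ p
        ... | inj₂ l | inj₂ m | inj₂ r = inj₂ (l , m , r)
      ... | inj₁ p           | _      = inj₁ (≼-trans (∧-glb ≼-refl ⊤≼◇⊤) p)
      ... | inj₂ _           | inj₁ p = inj₁ p
      ... | inj₂ (t , e , _) | inj₂ g = inj₂ record { successor = t , e ; good = g }

  abstract

    -- Elimination as long as possible.
    elimination : ∃[ E ] (∀ s → E s ≡ true → Null ⟪ s ⟫) × (∀ s → E s ≡ false → Good E s)
    elimination = saturate listedState (Null ∘ ⟪_⟫) Good null-or-good

  -- The initial watch list has a fresh watch for every EG-formula.
  initial : Vec Watch K
  initial = Vec.map (λ e → watch e Subset.⊥ false) (Vec.fromList (elements fairs))

  initial-full : ∀ e → e ∈ʷ initial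
  initial-full e = occurs (complete fairs e)
    where
    occurs : ∀ {e es} → e ∈ es → e ∈ʷ Vec.map (λ e → watch e Subset.⊥ false) (Vec.fromList es)
    occurs (here refl) = Vec∃.here refl
    occurs (there i)   = Vec∃.there (occurs i)

  null-or-initial : ∀ (E : State → Bool) → (∀ s → E s ≡ true → Null ⟪ s ⟫) → ∀ {ψ} (i : ψ ∈ Γ) →
                    Null ⟦ ψ ⟧ ⊎ ∃[ v ] E (v , initial) ≡ false × v ∋ i
  null-or-initial E sound {ψ} i with all⊎any (listedFin N) candidate
    where
    initial-fresh : ∀ {k} (es : Vec (Fair Γ) k) →
                    Vec∀.All (λ x → x ≡ fresh x) (Vec.map (λ e → watch e Subset.⊥ false) es)
    initial-fresh []       = Vec∀.[]
    initial-fresh (e ∷ es) = refl Vec∀.∷ initial-fresh es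

    candidate : ∀ v → Null (τ v ∧ ⟦ ψ ⟧) ⊎ (E (v , initial) ≡ false × v ∋ i)
    candidate v with null-or-∋ i v | E (v , initial) in eqE
    ... | inj₁ p | _     = inj₁ p
    ... | inj₂ p | false = inj₂ (refl , p)
    ... | inj₂ _ | true  = inj₁ (≼-trans fst (≼-trans
          (∧-glb ≼-refl (≼-trans □-⊤ (□-mono (promises-fresh
              (initial-fresh (Vec.fromList (elements fairs))))))) (sound _ eqE)))
  ... | inj₁ null = inj₁ (types-cover Null ≼-trans ∨-lub null)
  ... | inj₂ h    = inj₂ h

  -- A set E of states such that all states outside E are good, and a state outside
  -- E that carries the initial watch list.
  record Surviving : Set where
    field
      E              : State → Bool
      survivors-good : ∀ s → E s ≡ false → Good E s
      v₀             : Fin N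
      v₀-survives    : E (v₀ , initial) ≡ false

  null-or-surviving : ∀ {ψ} (i : ψ ∈ Γ) → Null ⟦ ψ ⟧ ⊎ ∃ λ S → Surviving.v₀ S ∋ i
  null-or-surviving i with elimination
  ... | E , sound , survivors-good with null-or-initial E sound i
  ...   | inj₁ null          = inj₁ null
  ...   | inj₂ (v , v∉E , e) = inj₂
          ( record { E = E ; survivors-good = survivors-good ; v₀ = v ; v₀-survives = v∉E } , e)

-- Unravelling a graph into a tree

module Unravelling {Label : Set} (Edge : Label → Label → Set)
  (successor : ∀ l → ∃ (Edge l)) (l₀ : Label) where

  infixl 5 _▹_
  data Walk : Label → Set where
    start : Walk l₀
    _▹_   : ∀ {l m} → Walk l → Edge l m → Walk m

  -- The nodes are the finite walks from l₀, and each is joined to its one-step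
  -- extensions.
  system : TransitionSystem
  system = record
    { Node   = ∃ Walk
    ; R      = λ (l , w) (m , w′) → Σ (Edge l m) λ e → w′ ≡ w ▹ e
    ; serial = λ (l , w) → let (m , e) = successor l in (m , w ▹ e) , e , refl
    }

  open TransitionSystem system

  root : Node
  root = l₀ , start

  -- The proper prefixes of a walk.
  before : ∀ {l} → Walk l → List Node
  before start   = []
  before (w ▹ e) = before w ∷ʳ (_ , w)

  -- A path visits all nodes between its ends.
  before-nodes : ∀ {s t} (π : Star R s t) →
                 before (proj₂ s) ++ nodes π ≡ before (proj₂ t) ∷ʳ t
  before-nodes ε = refl
  before-nodes {s} {t} (_◅_ {j = _ , _} (e , refl) π) = begin
    before (proj₂ s) ++ s ∷ nodes π    ≡⟨ sym (List.++-assoc (before (proj₂ s)) [ s ] (nodes π)) ⟩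
    (before (proj₂ s) ∷ʳ s) ++ nodes π ≡⟨ before-nodes π ⟩
    before (proj₂ t) ∷ʳ t              ∎
    where open ≡-Reasoning

  from-root : ∀ {l} (w : Walk l) → Star R root (l , w)
  from-root start   = ε
  from-root (w ▹ e) = from-root w ◅◅ (e , refl) ◅ ε

  nodes-to-root : ∀ s (π : Star R s root) → nodes π ≡ [ root ]
  nodes-to-root s π with before (proj₂ s) | before-nodes π
  ... | []     | eq = eq
  ... | _ ∷ bs | eq with List.++-conicalʳ bs (nodes π) (List.∷-injectiveʳ eq)
  ...   | none with List.++-conicalʳ (nonFinalNodes π) [ root ] none
  ...     | ()

  tree : Tree
  tree = record
    { transitionSystem = system
    ; root             = root
    ; isRoot           = (λ (l , w) → from-root w) , nodes-to-root
    ; uniquePath       = λ (l , w) → from-root w , λ π →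
                           trans (before-nodes (from-root w)) (sym (before-nodes π))
    }

-- The model

module Model {c ℓ} (𝔸 : CTLᶠ-Algebra c ℓ)
  {n : ℕ} (V : Fin n → CTLᶠ-Algebra.Carrier 𝔸) (Γ : List (Formula n))
  (closed : ∀ {ψ χ} → χ ∈ Γ → ψ ◁ χ → ψ ∈ Γ)
  (variable-∈ : ∀ p → var p ∈ Γ)
  (survivors : Elimination.Surviving 𝔸 V Γ closed variable-∈)
  where

  open Elimination 𝔸 V Γ closed variable-∈
  open Surviving survivors
  open Watching alive meets

  -- A finite lazy path.
  data Plan : State → Set where
    done   : ∀ {s} → Plan s
    follow : ∀ {s t} → Lazy E s t → Plan t → Plan s

  plan : ∀ {P Q s} → Reaches E P Q s → Plan s
  plan (stop _)     = done
  plan (step _ l r) = follow l (plan r)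

  -- A label is a surviving state that watches every EG-formula, together with a plan,
  -- which may be followed or abandoned.
  record Label : Set where
    constructor label
    field
      state    : State
      survives : E state ≡ false
      full     : ∀ e → e ∈ʷ proj₂ state
      todo     : Plan state

  open Label

  type : Label → Fin N
  type l = proj₁ (state l)

  -- A lazy step only occurs along a plan, and a strict step may adopt any plan.
  -- So an infinite branch takes infinitely many strict steps.
  data Edge : Label → Label → Set where
    strictly : ∀ {s t g g′ f f′ π π′} → Strict E s t → Edge (label s g f π) (label t g′ f′ π′)
    lazily   : ∀ {s t g g′ f f′ π} (l : Lazy E s t) →
               Edge (label s g f (follow l π)) (label t g′ f′ π)

  strict-full : ∀ {s t} → Strict E s t → (∀ e → e ∈ʷ proj₂ s) → ∀ e → e ∈ʷ proj₂ t
  strict-full {s} {t} h f e =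
    fire-keeps (proj₁ t) (Strict.fires h) (update-keeps (proj₁ t) (f e))

  lazy-full : ∀ {s t} → Lazy E s t → (∀ e → e ∈ʷ proj₂ s) → ∀ e → e ∈ʷ proj₂ t
  lazy-full {s} {t} l f e = subst (e ∈ʷ_) (Lazy.updates l) (update-keeps (proj₁ t) (f e))

  edge-coherent : ∀ {l m} → Edge l m → Coherent (type l) (type m)
  edge-coherent (strictly h) = Strict.coherent h
  edge-coherent (lazily l)   = Lazy.coherent l

  module _ (l : Label) {ψ} (i : ψ ∈ Γ) where

    private
      good : GoodAt E (state l) ψ i
      good = Good.good (survivors-good (state l) (survives l)) ψ i

    local : LocalAt (type l) ψ i
    local = proj₁ good

    succeeds : SuccessorAt E (state l) ψ i
    succeeds = proj₁ (proj₂ good)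

    path : PathAt E (state l) ψ i
    path = proj₂ (proj₂ good)

  -- The label after a strict step, with a given plan.
  arrive : ∀ l {t} → Strict E (state l) t → Plan t → Label
  arrive l {t} h π = label t (Strict.survives h) (strict-full h (full l)) π

  successor : ∀ l → ∃ (Edge l)
  successor l =
    let (t , h) = Good.successor (survivors-good (state l) (survives l))
    in arrive l h done , strictly h

  open Unravelling Edge successor (label (v₀ , initial) v₀-survives initial-full done) public

  colouredTree : ColouredTree n
  colouredTree = record
    { tree      = tree
    ; colouring = λ (l , _) → Vec.tabulate λ p → val (variable-∈ p) (type l)
    }

  open TransitionSystem system using (Node; R; nonFinalNodes; InfinitePath)
  open Forcing system (ColouredTree.colouring colouredTree)

  typeᴺ : Node → Fin N
  typeᴺ (l , _) = type l

  R⇒coherent : ∀ {s t} → R s t → Coherent (typeᴺ s) (typeᴺ t)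
  R⇒coherent (e , _) = edge-coherent e

  -- From a label that carries the plan of a lazy path, the path exists in the tree.
  follow-plan : ∀ {P Q s g f} (r : Reaches E P Q s) (w : Walk (label s g f (plan r))) →
                ∃[ t ] Σ (Star R (_ , w) t) λ π →
                  All (Q ∘ typeᴺ) (nonFinalNodes π) × P (typeᴺ t)
  follow-plan (stop p) w = _ , ε , [] , p
  follow-plan {f = f} (step q l r) w
    with follow-plan {g = Lazy.survives l} {f = lazy-full l f} r (w ▹ lazily l)
  ... | t , π , qs , p = t , (lazily l , refl) ◅ π , q ∷ qs , p

  -- A branch on which φ holds throughout and ψ again and again, starting from a
  -- label that satisfies EG φ ψ: follow a lazy path to the next node satisfying
  -- ψ and EG φ ψ, take a strict step there and adopt a new path.
  module Branch {φ ψ} (i : EGᶠ φ ψ ∈ Γ) where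

    Goal : Fin N → Set
    Goal v = v ∋ closed i EG◁ʳ × v ∋ i

    record Stage : Set where
      constructor stage
      field
        {current}   : State
        {survival}  : E current ≡ false
        {full-now}  : ∀ e → e ∈ʷ proj₂ current
        route       : Reaches E Goal (_∋ closed i EG◁ˡ) current
        walk        : Walk (label current survival full-now (plan route))

    open Stage

    node : Stage → Node
    node x = _ , walk x

    depart : ∀ (m : Node) → typeᴺ m ∋ i → ∃[ y ] R m (node y)
    depart (l , w) e =
      let (t , h , e′) = succeeds l i e
          r            = path (arrive l h done) i e′
      in stage r (w ▹ strictly {g′ = Strict.survives h} {f′ = strict-full h (full l)} h) ,
         strictly h , refl

    next : ∀ x → ∃[ y ] R (node x) (node y)
    next (stage (stop (_ , e)) w) = depart (_ , w) e
    next (stage {full-now = f} (step _ l r) w) =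
      stage r (w ▹ lazily {g′ = Lazy.survives l} {f′ = lazy-full l f} l) , lazily l , refl

    advance : Stage → Stage
    advance x = proj₁ (next x)

    stages : Stage → ℕ → Stage
    stages x zero    = x
    stages x (suc t) = advance (stages x t)

    stages-+ : ∀ x d m → stages (stages x m) d ≡ stages x (d + m)
    stages-+ x zero    m = refl
    stages-+ x (suc d) m = cong advance (stages-+ x d m)

    stages-advance : ∀ x d → stages (advance x) d ≡ advance (stages x d)
    stages-advance x zero    = refl
    stages-advance x (suc d) = cong advance (stages-advance x d)

    holds : ∀ x → typeᴺ (node x) ∋ closed i EG◁ˡ
    holds x@(stage (stop (_ , e)) w) = local (proj₁ (node x)) i e
    holds (stage (step q _ _) w)     = q

    recurs : ∀ x → ∃[ d ] typeᴺ (node (stages x d)) ∋ closed i EG◁ʳ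
    recurs x@(stage r w) = go r w
      where
      go : ∀ {s g f} (r : Reaches E Goal (_∋ closed i EG◁ˡ) s) (w : Walk (label s g f (plan r))) →
           ∃[ d ] typeᴺ (node (stages (stage r w) d)) ∋ closed i EG◁ʳ
      go (stop (p , _)) w = 0 , p
      go {f = f} (step q l r) w
        with go {g = Lazy.survives l} {f = lazy-full l f} r (w ▹ lazily l)
      ... | d , p = suc d , subst (λ y → typeᴺ (node y) ∋ closed i EG◁ʳ)
                              (stages-advance (stage (step q l r) w) d) p

    branch : ∀ m → typeᴺ m ∋ i →
             ∃[ f ] f zero ≡ m × InfinitePath f × (∀ t → typeᴺ (f t) ∋ closed i EG◁ˡ) ×
                    (∀ k → ∃[ t ] k ≤ t × typeᴺ (f t) ∋ closed i EG◁ʳ)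
    branch m e = f , refl , steps , always , again
      where
      x : Stage
      x = proj₁ (depart m e)

      f : ℕ → Node
      f zero    = m
      f (suc t) = node (stages x t)

      steps : InfinitePath f
      steps zero    = proj₂ (depart m e)
      steps (suc t) = proj₂ (next (stages x t))

      always : ∀ t → typeᴺ (f t) ∋ closed i EG◁ˡ
      always zero    = local (proj₁ m) i e
      always (suc t) = holds (stages x t)

      again : ∀ k → ∃[ t ] k ≤ t × typeᴺ (f t) ∋ closed i EG◁ʳ
      again k with recurs (stages x k)
      ... | d , p = suc (d + k) , ≤-trans (m≤n+m k d) (n≤1+n _) ,
                    subst (λ y → typeᴺ (node y) ∋ closed i EG◁ʳ) (stages-+ x d k) p

  remaining : ∀ {s} → Plan s → ℕ
  remaining done         = 0
  remaining (follow _ π) = suc (remaining π)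

  -- The effect of a step on the watch of an EG-formula that stays alive.  Suppose
  -- that its measure does not decrease.  Then either the watch was not armed and the
  -- new node does not meet e, or the step follows the plan, and the watch is armed
  -- afterwards if it was before or the new node meets e.
  edge-effect : ∀ {e l l′} → Edge l l′ → alive e (type l′) ≡ true → (m : e ∈ʷ proj₂ (state l)) →
    ∃ λ (m′ : e ∈ʷ proj₂ (state l′)) → measure m′ < measure m ⊎
      (measure m′ ≡ measure m ×
        ( armedAt m || meets e (type l′) ≡ false
        ⊎ (armedAt m′ ≡ armedAt m || meets e (type l′) ×
           remaining (todo l) ≡ suc (remaining (todo l′)))))
  edge-effect {e} {l′ = l′} (strictly h) al m with update-measure (type l′) al m
  ... | m₁ , _ , change₁ with fire-measure (type l′) (Strict.fires h) m₁
  ...   | m₂ , _ , change₂ = m₂ , combine change₁ change₂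
    where
    combine : ∀ {x₀ x₁ x₂ : ℕ} {f₀ f₁ : Bool} {C A B : Set} →
              x₁ < x₀ ⊎ (C × x₁ ≡ x₀ × f₁ ≡ f₀) → x₂ < x₁ ⊎ (x₂ ≡ x₁ × f₁ ≡ false) →
              x₂ < x₀ ⊎ (x₂ ≡ x₀ × (f₀ ≡ false ⊎ (A × B)))
    combine (inj₁ p)              (inj₁ q)          = inj₁ (<-trans q p)
    combine (inj₁ p)              (inj₂ (refl , _)) = inj₁ p
    combine (inj₂ (_ , refl , _)) (inj₁ q)          = inj₁ q
    combine (inj₂ (_ , p , r))    (inj₂ (q , u))    = inj₂ (trans q p , inj₁ (trans (sym r) u))
  edge-effect {e} {l′ = l′} (lazily record { updates = refl }) al m
    with update-measure (type l′) al m
  ... | m′ , _ , inj₁ p           = m′ , inj₁ p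
  ... | m′ , _ , inj₂ (_ , p , r) = m′ , inj₂ (p , inj₂ (r , refl))

  -- Conversely, no branch starting from a label that does not satisfy EG φ ψ
  -- satisfies φ throughout and ψ infinitely often: unless the measure of
  -- the watch of EG φ ψ decreases earlier, a later visit to ψ arms this watch, and
  -- the next strict step decreases the measure.
  module Refutation {φ ψ} (i : EGᶠ φ ψ ∈ Γ) (f : ℕ → Label) (edge : ∀ t → Edge (f t) (f (suc t)))
    (always : ∀ t → type (f t) ∋ closed i EG◁ˡ)
    (again : ∀ k → ∃[ t ] k ≤ t × type (f t) ∋ closed i EG◁ʳ)
    (¬i : val i (type (f 0)) ≡ false)
    where

    private
      e : Fair Γ
      e = φ , ψ , i

      clash : ∀ {b} {A : Set} → b ≡ true → b ≡ false → A
      clash refl ()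

    never : ∀ t → val i (type (f t)) ≡ false
    never zero = ¬i
    never (suc t) with val i (type (f (suc t))) in eq
    ... | false = refl
    ... | true  = trans (sym (edge-coherent (edge t) _ i (always t) eq)) (never t)

    alive-always : ∀ t → alive e (type (f t)) ≡ true
    alive-always t rewrite always t | never t = refl

    WatchAt : ℕ → Set
    WatchAt t = e ∈ʷ proj₂ (state (f t))

    Decreases : ∀ {t} → WatchAt t → Set
    Decreases m = ∃[ t′ ] ∃ λ (m′ : WatchAt t′) → measure m′ < measure m

    decreases-≡ : ∀ {t t′} {m : WatchAt t} {m′ : WatchAt t′} → measure m′ ≡ measure m →
                  Decreases m′ → Decreases m
    decreases-≡ eq (t″ , m″ , lt) = t″ , m″ , <-≤-trans lt (≤-reflexive eq)

    armed-decreases : ∀ k t (m : WatchAt t) → armedAt m ≡ true → remaining (todo (f t)) ≡ k →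
                      Decreases m
    armed-decreases k t m ar rem with edge-effect (edge t) (alive-always (suc t)) m
    ... | m′ , inj₁ lt                   = suc t , m′ , lt
    ... | m′ , inj₂ (eq , inj₁ unarmed)  =
          clash (cong (_|| meets e (type (f (suc t)))) ar) unarmed
    armed-decreases zero t m ar rem    | m′ , inj₂ (eq , inj₂ (ar′ , rem′))
      with trans (sym rem) rem′
    ... | ()
    armed-decreases (suc k) t m ar rem | m′ , inj₂ (eq , inj₂ (ar′ , rem′)) =
      decreases-≡ {t} {m = m} {m′ = m′} eq
        (armed-decreases k (suc t) m′ (trans ar′ (cong (_|| meets e (type (f (suc t)))) ar))
          (suc-injective (trans (sym rem′) rem)))

    meets-decreases : ∀ d t (m : WatchAt t) → meets e (type (f (d + suc t))) ≡ true → Decreases m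
    meets-decreases d t m me with edge-effect (edge t) (alive-always (suc t)) m
    ... | m′ , inj₁ lt = suc t , m′ , lt
    meets-decreases zero t m me | m′ , inj₂ (eq , inj₁ unarmed) =
      clash (trans (cong (armedAt m ||_) me) (||-zeroʳ (armedAt m))) unarmed
    meets-decreases zero t m me | m′ , inj₂ (eq , inj₂ (ar′ , _)) =
      decreases-≡ {t} {m = m} {m′ = m′} eq
        (armed-decreases _ (suc t) m′
          (trans ar′ (trans (cong (armedAt m ||_) me) (||-zeroʳ (armedAt m)))) refl)
    meets-decreases (suc d) t m me | m′ , inj₂ (eq , _) =
      decreases-≡ {t} {m = m} {m′ = m′} eq
        (meets-decreases d (suc t) m′
          (subst (λ k → meets e (type (f k)) ≡ true) (sym (+-suc d (suc t))) me))

    always-decreases : ∀ t (m : WatchAt t) → Decreases m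
    always-decreases t m with again (suc t)
    ... | t′ , t<t′ , me = meets-decreases (t′ ∸ suc t) t m
          (subst (λ k → meets e (type (f k)) ≡ true) (sym (m∸n+n≡m t<t′)) me)

    descent : ∀ t (m : WatchAt t) → Acc _<_ (measure m) → ⊥
    descent t m (acc rec) with always-decreases t m
    ... | t′ , m′ , lt = descent t′ m′ (rec lt)

    impossible : ⊥
    impossible = descent 0 (full (f 0) e) (<-wellFounded _)

  -- The truth lemma, by induction on the formula: a node forces exactly the
  -- members of Γ that belong to its type.
  ⊩⇒∋ : ∀ ψ (i : ψ ∈ Γ) s → s ⊩ ψ → typeᴺ s ∋ i
  ∋⇒⊩ : ∀ ψ (i : ψ ∈ Γ) s → typeᴺ s ∋ i → s ⊩ ψ

  private
    refute : ∀ {b} → (b ≡ true → ⊥) → not b ≡ true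
    refute {true}  h = ⊥-elim (h refl)
    refute {false} h = refl

    ||-true : ∀ {a b} → a || b ≡ true → a ≡ true ⊎ b ≡ true
    ||-true {true}  _ = inj₁ refl
    ||-true {false} p = inj₂ p

  ⊩⇒∋ (var p) i s p∈σ =
    trans (local (proj₁ s) i)
      (trans (sym (lookup∘tabulate (λ p → val (variable-∈ p) (typeᴺ s)) p)) ([]=⇒lookup p∈σ))
  ⊩⇒∋ (¬ᶠ ψ) i s s⊮ψ =
    trans (local (proj₁ s) i) (refute λ e → s⊮ψ (∋⇒⊩ ψ (closed i ¬◁) s e))
  ⊩⇒∋ (◇ᶠ ψ) i s (t , r , t⊩ψ) = R⇒coherent r _ i (⊩⇒∋ ψ (closed i ◇◁) t t⊩ψ)
  ⊩⇒∋ (φ ∨ᶠ ψ) i s (inj₁ h) =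
    trans (local (proj₁ s) i)
      (cong (_|| val (closed i ∨◁ʳ) (typeᴺ s)) (⊩⇒∋ φ (closed i ∨◁ˡ) s h))
  ⊩⇒∋ (φ ∨ᶠ ψ) i s (inj₂ h) =
    trans (local (proj₁ s) i)
      (trans (cong (val (closed i ∨◁ˡ) (typeᴺ s) ||_) (⊩⇒∋ ψ (closed i ∨◁ʳ) s h)) (||-zeroʳ _))
  ⊩⇒∋ (EUᶠ φ ψ) i s (t , π , hs , h) = go π hs
    where
    go : ∀ {s} (π : Star R s t) → All (_⊩ ψ) (nonFinalNodes π) → typeᴺ s ∋ i
    go {s} ε       _         = proj₁ (local (proj₁ s) i) (⊩⇒∋ φ (closed i EU◁ˡ) s h)
    go {s} (r ◅ π) (h′ ∷ hs) = R⇒coherent r _ i (⊩⇒∋ ψ (closed i EU◁ʳ) s h′) (go π hs)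
  ⊩⇒∋ (EGᶠ φ ψ) i s (f , refl , steps , always , again) with val i (typeᴺ (f 0)) in eq
  ... | true  = refl
  ... | false = ⊥-elim (Refutation.impossible i (proj₁ ∘ f) (proj₁ ∘ steps)
          (λ t → ⊩⇒∋ φ (closed i EG◁ˡ) (f t) (always t))
          (λ k → let (t , k≤t , h) = again k in t , k≤t , ⊩⇒∋ ψ (closed i EG◁ʳ) (f t) h)
          eq)

  ∋⇒⊩ (var p) i s e =
    lookup⇒[]= p _ (trans (lookup∘tabulate (λ p → val (variable-∈ p) (typeᴺ s)) p)
                     (trans (sym (local (proj₁ s) i)) e))
  ∋⇒⊩ ⊥ᶠ i s e with trans (sym (local (proj₁ s) i)) e
  ... | ()
  ∋⇒⊩ (¬ᶠ ψ) i s e s⊩ψ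
    with trans (sym (cong not (⊩⇒∋ ψ (closed i ¬◁) s s⊩ψ))) (trans (sym (local (proj₁ s) i)) e)
  ... | ()
  ∋⇒⊩ (◇ᶠ ψ) i (l , w) e =
    let (t , h , e′) = succeeds l i e
        m            = arrive l h done , w ▹ strictly h
    in m , (strictly h , refl) , ∋⇒⊩ ψ (closed i ◇◁) m e′
  ∋⇒⊩ (φ ∨ᶠ ψ) i s e with ||-true (trans (sym (local (proj₁ s) i)) e)
  ... | inj₁ e′ = inj₁ (∋⇒⊩ φ (closed i ∨◁ˡ) s e′)
  ... | inj₂ e′ = inj₂ (∋⇒⊩ ψ (closed i ∨◁ʳ) s e′)
  ∋⇒⊩ (EUᶠ φ ψ) i s@(l , w) e with proj₂ (local l i) e | succeeds l i e
  ... | inj₁ e′ | _       = s , ε , [] , ∋⇒⊩ φ (closed i EU◁ˡ) s e′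
  ... | inj₂ _  | inj₁ e′ = s , ε , [] , ∋⇒⊩ φ (closed i EU◁ˡ) s e′
  ... | inj₂ q  | inj₂ (t , h , e′)
    with follow-plan (path (arrive l h done) i e′)
           (w ▹ strictly {g′ = Strict.survives h} {f′ = strict-full h (full l)} h)
  ...   | u , π , qs , p =
          u , (strictly h , refl) ◅ π ,
          ∋⇒⊩ ψ (closed i EU◁ʳ) s q ∷ All.map (∋⇒⊩ ψ (closed i EU◁ʳ) _) qs ,
          ∋⇒⊩ φ (closed i EU◁ˡ) u p
  ∋⇒⊩ (EGᶠ φ ψ) i s e with Branch.branch i s e
  ... | f , eq , steps , always , again =
        f , eq , steps , (λ t → ∋⇒⊩ φ (closed i EG◁ˡ) (f t) (always t)) ,
        λ k → let (t , k≤t , h) = again k in t , k≤t , ∋⇒⊩ ψ (closed i EG◁ʳ) (f t) h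

  model : ∀ {ψ} (i : ψ ∈ Γ) → v₀ ∋ i → ∃ λ (T : ColouredTree n) → T , ColouredTree.root T ⊩ ψ
  model {ψ} i v₀∋ψ = colouredTree , ∋⇒⊩ ψ i root v₀∋ψ

theorem3p2 : ∀ {c ℓ : Level} {n : ℕ} (φ₀ : Formula n) → Consistent c ℓ φ₀ →
    ∃ λ (T : ColouredTree n) → T , ColouredTree.root T ⊩ φ₀
theorem3p2 φ₀ (𝔸 , V , φ₀≉⊥) =
  [ (λ null → ⊥-elim (φ₀≉⊥ (TemporalAlgebra.null⇒≈⊥ 𝔸 null)))
  , (λ (survivors , v₀∋φ₀) → model survivors (∈-closure φ₀) v₀∋φ₀)
  ]′ (Elimination.null-or-surviving 𝔸 V (closure φ₀) (closure-closed φ₀)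
        (variable-∈-closure φ₀) (∈-closure φ₀))
  where
  open Model 𝔸 V (closure φ₀) (closure-closed φ₀) (variable-∈-closure φ₀) using (model)
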